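{- Let $(W,S)$ be a finite irreducible Coxeter system, let $\mathcal{P}$ be a (real) parameter tensor for $(W,S)$, and let $v=v_1\cdots v_N\in\mathcal{R}(w_\circ)$ be a reduced word of the longest element $w_\circ$, with abelian vector $\alpha_v$. Let $x_1,\dots,x_N$ be real numbers. If $x_i>0$ for all $i\in[N]$ and $x_j>x_i$ whenever $i<j$ and $v_i=v_j$, then \[ \operatorname{sign}\big(\det M(v,\mathcal{P})\big)=\sigma(v)\,\operatorname{sign}\Big(\sum_{\mathfrak{z}\in\mathfrak{Z}_{\alpha_v}}\det[\mathcal{P}]_{\mathfrak{z}}\;\mathsf{S}_{\Lambda_{\mathfrak{z}},\Omega_v}\Big), \] where the model matrix and the partial Schur functions are evaluated at $x_1,\dots,x_N$ and $\operatorname{sign}$ is the usual sign function $\mathbb{R}\to\{ -1,0,1\}$.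
   Context: Setting. $(W,S)$ is a finite irreducible Coxeter system with $S=\{s_1<\dots<s_n\}$, $w_\circ$ is its longest element, $N$ is the length of $w_\circ$, $\mathcal{R}(w_\circ)$ is the set of reduced words of $w_\circ$ (words of length $N$ in $S$ representing $w_\circ$), and $\nu$ is the maximum number of occurrences of a letter in any word of $\mathcal{R}(w_\circ)$. Words. For $v=v_1\cdots v_N$, let $\{v\}_i:=\{j\in[N]:v_j=s_i\}$ and $c_i:=\#\{v\}_i$; the abelian vector is $\alpha_v=(c_1,\dots,c_n)$, and $\Omega_v:=(\{v\}_1,\dots,\{v\}_n)$. The $S$-sign is $\sigma(v)=(-1)^{\operatorname{inv}(v)}$, where $\operatorname{inv}(v)$ is the number of pairs $a<b$ with $v_b<v_a$. Parameter tensor and model matrix. A parameter tensor for $(W,S)$ is a real array $\mathcal{P}=(p^i{}_{s,k})$ with $(i,s,k)\in[N]\times S\times\{0,\dots,\nu-1\}$, regarded as an $N\times n\nu$ matrix with rows indexed by $i$ and columns indexed by pairs $(s,k)$ in lexicographic order. The model matrix $M(v,\mathcal{P})$ is the $N\times N$ matrix whose $(i,l)$ entry is $\sum_{k=0}^{\nu-1}p^i{}_{v_l,k}\,x_l^{k}$. Minors. $\mathfrak{Z}_{\alpha_v}$ is the collection of subsets $\mathfrak{z}\subseteq S\times\{0,\dots,\nu-1\}$ containing exactly $c_i$ elements with first coordinate $s_i$, for every $i\in[n]$. $[\mathcal{P}]_{\mathfrak{z}}$ is the $N\times N$ submatrix of $\mathcal{P}$ with columns $\mathfrak{z}$ in increasing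 lexicographic order. For $\mathfrak{z}\in\mathfrak{Z}_{\alpha_v}$, $\Lambda_{\mathfrak{z}}=(\lambda^{\mathfrak{z},1},\dots,\lambda^{\mathfrak{z},n})$, where $\lambda^{\mathfrak{z},i}$ is obtained by listing the second coordinates of the elements of $\mathfrak{z}$ with first coordinate $s_i$ in decreasing order and subtracting $c_i-j$ from the entry at position $j$, $j=1,\dots,c_i$. Schur functions. For a partition $\lambda=(\lambda_1\ge\dots\ge\lambda_d\ge0)$ and an ordered index set $J$ with $\#J=d$, $\mathsf{s}_{\lambda,J}$ is the polynomial \[\mathsf{s}_{\lambda,J}:=\frac{\det\big(x_j^{\,i-1+\lambda_{d-i+1}}\big)_{(i,j)\in[d]\times J}}{\det\big(x_j^{\,i-1}\big)_{(i,j)\in[d]\times J}}\] (quotient taken as polynomials in the variables $x_j$). For an ordered set partition $P=(p_1,\dots,p_n)$ of $[N]$ (empty parts allowed) and a sequence $\Lambda=(\lambda^1,\dots,\lambda^n)$ of partitions where $\lambda^i$ has $\#p_i$ parts (parts may be zero), the partial Schur function is $\mathsf{S}_{\Lambda,P}:=\prod_{i=1}^n\mathsf{s}_{\lambda^i,p_i}$. -}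

module Defs where

open import Algebra.Bundles using (Group; CommutativeRing)
import Algebra.Definitions.RawMagma as RawMagmaDefinitions
import Algebra.Properties.CommutativeMonoid.Sum as CommutativeMonoidSum
import Algebra.Properties.Ring as RingProperties
import Algebra.Properties.Semiring.Exp as SemiringExp
import Algebra.Properties.Semiring.Sum as SemiringSum
import Algebra.Solver.Ring.NaturalCoefficients.Default as SemiringSolver
open import Data.Bool.Base using (Bool; if_then_else_)
open import Data.Empty using (⊥-elim)
open import Data.Fin.Base as Fin
  using (Fin; zero; suc; toℕ; punchIn; pinch; opposite; combine; remQuot; _↑ˡ_; _↑ʳ_)
import Data.Fin.Properties as Fin
open import Data.Fin.Subset using (Subset; inside; outside; ∣_∣)
open import Data.Integer.Base as ℤ using (ℤ; 0ℤ; 1ℤ; -1ℤ)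
open import Data.List.Base as List using (List; []; _∷_; _++_; length)
open import Data.Nat.Base as ℕ using (ℕ; zero; suc; NonZero)
import Data.Nat.Properties as ℕ
open import Data.Product.Base using (∃; ∃-syntax; _×_; _,_; proj₁; proj₂; uncurry)
open import Data.Vec.Base as Vec using (Vec; []; _∷_; lookup; tabulate; toList)
import Data.Vec.Properties as Vec
open import Function.Base using (_∘_)
open import Function.Bundles using (Inverse; _⇔_)
open import Level using (Level; _⊔_) renaming (suc to lsuc)
open import Relation.Binary.Construct.Closure.ReflexiveTransitive using (Star)
open import Relation.Binary.Core using (Rel)
open import Relation.Binary.Definitions using (tri<; tri≈; tri>)
open import Relation.Binary.PropositionalEquality as ≡ using (_≡_; _≢_)
import Relation.Binary.Reasoning.Setoid as SetoidReasoning
open import Relation.Binary.Structures using (IsStrictTotalOrder; IsEquivalence)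
open import Relation.Nullary.Decidable using (Dec; yes; no; does; _×-dec_)
open import Relation.Nullary.Negation using (¬_)

private
  variable
    a b c ℓ ℓ₁ ℓ₂ : Level
    k m n N ν : ℕ

------------------------------------------------------------------------
-- Determinants

module Determinant (R : CommutativeRing c ℓ) where

  open CommutativeRing R hiding (zero)
  open SemiringSum semiring using (sum; sum-syntax)
  open SemiringExp semiring using (_^_)

  Matrix : ℕ → ℕ → Set c
  Matrix m n = Fin m → Fin n → Carrier

  -- Laplace expansion along the first column.
  det : Matrix n n → Carrier
  det {zero}  A = 1#
  det {suc n} A =
    ∑[ i < suc n ] ((- 1#) ^ toℕ i * (A i zero * det (λ r s → A (punchIn i r) (suc s))))

------------------------------------------------------------------------
-- Divisibility of alternants by the Vandermonde determinant

module Alternant (R : CommutativeRing c ℓ) where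

  open CommutativeRing R hiding (zero)
  open RingProperties ring using (-1*x≈-x; -‿involutive)
  open SemiringSum semiring
    using (sum; sum-syntax; sum-cong-≋; ∑-distrib-+; *-distribˡ-sum; *-distribʳ-sum; sum-replicate-zero)
  open SemiringExp semiring using (_^_)
  open CommutativeMonoidSum *-commutativeMonoid using () renaming (sum to ∏)
  open RawMagmaDefinitions *-rawMagma using (_∣_; _,_; module _∣ʳ_)
  open SetoidReasoning setoid
  open SemiringSolver commutativeSemiring using (solve; con; _:+_; _:*_; _:=_)
  open Determinant R

  sgn : Fin n → Carrier
  sgn i = (- 1#) ^ toℕ i

  minor : Matrix (suc n) (suc n) → Fin (suc n) → Matrix n n
  minor A i r s = A (punchIn i r) (suc s)

  ∑-zero : {f : Fin n → Carrier} → (∀ i → f i ≈ 0#) → sum f ≈ 0#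
  ∑-zero {n} f≈0 = trans (sum-cong-≋ f≈0) (sum-replicate-zero n)

  det-cong : {A B : Matrix n n} → (∀ r s → A r s ≈ B r s) → det A ≈ det B
  det-cong {zero}  A≈B = refl
  det-cong {suc n} A≈B = sum-cong-≋ λ i →
    *-congˡ {sgn i} (*-cong (A≈B i zero) (det-cong λ r s → A≈B (punchIn i r) (suc s)))

  det-linear : (j : Fin n) (A B C : Matrix n n) (t : Carrier) →
               (∀ r → B r j ≈ A r j + t * C r j) →
               (∀ r s → s ≢ j → B r s ≈ A r s) →
               (∀ r s → s ≢ j → C r s ≈ A r s) →
               det B ≈ det A + t * det C
  det-linear {suc n} j A B C t Bj B≈A C≈A = begin
    det B                                    ≈⟨ sum-cong-≋ (term j Bj B≈A C≈A) ⟩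
    sum (λ i → α i + t * γ i)                ≈⟨ ∑-distrib-+ α (λ i → t * γ i) ⟩
    det A + sum (λ i → t * γ i)              ≈⟨ +-congˡ (sym (*-distribˡ-sum t γ)) ⟩
    det A + t * det C                        ∎
    where
    α γ : Fin (suc n) → Carrier
    α i = sgn i * (A i zero * det (minor A i))
    γ i = sgn i * (C i zero * det (minor C i))
    term : (j : Fin (suc n)) →
           (∀ r → B r j ≈ A r j + t * C r j) →
           (∀ r s → s ≢ j → B r s ≈ A r s) →
           (∀ r s → s ≢ j → C r s ≈ A r s) →
           ∀ i → sgn i * (B i zero * det (minor B i)) ≈ α i + t * γ i
    term zero Bj B≈A C≈A i = begin
      sgn i * (B i zero * det (minor B i))
        ≈⟨ *-congˡ (*-cong (Bj i) (det-cong λ r s → B≈A (punchIn i r) (suc s) λ ())) ⟩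
      sgn i * ((A i zero + t * C i zero) * det (minor A i))
        ≈⟨ lem (sgn i) (A i zero) t (C i zero) (det (minor A i)) ⟩
      α i + t * (sgn i * (C i zero * det (minor A i)))
        ≈⟨ +-congˡ (*-congˡ (*-congˡ (*-congˡ
             (det-cong λ r s → sym (C≈A (punchIn i r) (suc s) λ ()))))) ⟩
      α i + t * γ i ∎
      where
      lem : ∀ s a t c d → s * ((a + t * c) * d) ≈ s * (a * d) + t * (s * (c * d))
      lem = solve 5 (λ s a t c d → s :* ((a :+ t :* c) :* d) := s :* (a :* d) :+ t :* (s :* (c :* d))) refl
    term (suc j) Bj B≈A C≈A i = begin
      sgn i * (B i zero * det (minor B i))
        ≈⟨ *-congˡ (*-cong (B≈A i zero λ ()) (det-linear j (minor A i) (minor B i) (minor C i) t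
             (λ r → Bj (punchIn i r))
             (λ r s s≢j → B≈A (punchIn i r) (suc s) (s≢j ∘ Fin.suc-injective))
             (λ r s s≢j → C≈A (punchIn i r) (suc s) (s≢j ∘ Fin.suc-injective)))) ⟩
      sgn i * (A i zero * (det (minor A i) + t * det (minor C i)))
        ≈⟨ lem (sgn i) (A i zero) t (det (minor A i)) (det (minor C i)) ⟩
      α i + t * (sgn i * (A i zero * det (minor C i)))
        ≈⟨ +-congˡ (*-congˡ (*-congˡ (*-congʳ (sym (C≈A i zero λ ()))))) ⟩
      α i + t * γ i ∎
      where
      lem : ∀ s a t d e → s * (a * (d + t * e)) ≈ s * (a * d) + t * (s * (a * e))
      lem = solve 5 (λ s a t d e → s :* (a :* (d :+ t :* e)) := s :* (a :* d) :+ t :* (s :* (a :* e))) refl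

  det-scale : (r : Fin n → Carrier) (A : Matrix n n) →
              det (λ i j → r j * A i j) ≈ ∏ r * det A
  det-scale {zero}  r A = sym (*-identityˡ 1#)
  det-scale {suc n} r A = begin
    det (λ i j → r j * A i j)
      ≈⟨ sum-cong-≋ (λ i → trans
           (*-congˡ {sgn i} (*-congˡ {r zero * A i zero} (det-scale (r ∘ suc) (minor A i))))
           (lem (sgn i) (r zero) (A i zero) (∏ (r ∘ suc)) (det (minor A i)))) ⟩
    sum (λ i → ∏ r * (sgn i * (A i zero * det (minor A i))))
      ≈⟨ sym (*-distribˡ-sum (∏ r) (λ i → sgn i * (A i zero * det (minor A i)))) ⟩
    ∏ r * det A ∎
    where
    lem : ∀ s x a p d → s * ((x * a) * (p * d)) ≈ (x * p) * (s * (a * d))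
    lem = solve 5 (λ s x a p d → s :* ((x :* a) :* (p :* d)) := (x :* p) :* (s :* (a :* d))) refl

  det-zeroRow : (A : Matrix (suc n) (suc n)) → (∀ s → A zero s ≈ 0#) → det A ≈ 0#
  det-zeroRow {n} A A₀≈0 = ∑-zero (term A A₀≈0)
    where
    term : ∀ {n} (A : Matrix (suc n) (suc n)) → (∀ s → A zero s ≈ 0#) →
           ∀ i → sgn i * (A i zero * det (minor A i)) ≈ 0#
    term A A₀≈0 zero = begin
      1# * (A zero zero * det (minor A zero)) ≈⟨ *-congˡ (*-congʳ (A₀≈0 zero)) ⟩
      1# * (0# * det (minor A zero))          ≈⟨ *-congˡ (zeroˡ _) ⟩
      1# * 0#                                 ≈⟨ zeroʳ _ ⟩
      0#                                      ∎
    term {suc n} A A₀≈0 (suc i) = begin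
      sgn (suc i) * (A (suc i) zero * det (minor A (suc i)))
        ≈⟨ *-congˡ (*-congˡ (det-zeroRow (minor A (suc i)) (A₀≈0 ∘ suc))) ⟩
      sgn (suc i) * (A (suc i) zero * 0#)  ≈⟨ *-congˡ (zeroʳ _) ⟩
      sgn (suc i) * 0#                     ≈⟨ zeroʳ _ ⟩
      0#                                   ∎

  -- (i , k) ↦ (punchIn i k , pinch k i) is the involution that exchanges
  -- the two rows deleted by two successive Laplace expansions.

  punchIn-swap : (i : Fin (suc n)) (k : Fin n) → punchIn (punchIn i k) (pinch k i) ≡ i
  punchIn-swap zero    zero    = ≡.refl
  punchIn-swap zero    (suc k) = ≡.refl
  punchIn-swap (suc i) zero    = ≡.refl
  punchIn-swap (suc i) (suc k) = ≡.cong suc (punchIn-swap i k)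

  punchIn² : (i : Fin (suc (suc n))) (k : Fin (suc n)) (r : Fin n) →
             punchIn (punchIn i k) (punchIn (pinch k i) r) ≡ punchIn i (punchIn k r)
  punchIn² zero    zero    r       = ≡.refl
  punchIn² zero    (suc k) r       = ≡.refl
  punchIn² (suc i) zero    r       = ≡.refl
  punchIn² (suc i) (suc k) zero    = ≡.refl
  punchIn² (suc i) (suc k) (suc r) = ≡.cong suc (punchIn² i k r)

  sgn-swap : (i : Fin (suc n)) (k : Fin n) →
             sgn (punchIn i k) * sgn (pinch k i) ≈ - (sgn i * sgn k)
  sgn-swap zero k = begin
    ((- 1#) * sgn k) * sgn (pinch k zero)  ≈⟨ *-congˡ (pinch0 k) ⟩
    ((- 1#) * sgn k) * 1#                  ≈⟨ lem (sgn k) ⟩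
    - (1# * sgn k)                         ∎
    where
    pinch0 : ∀ {n} (k : Fin n) → sgn (pinch k zero) ≈ 1#
    pinch0 {suc n} zero    = refl
    pinch0 {suc n} (suc k) = refl
    lem : ∀ x → ((- 1#) * x) * 1# ≈ - (1# * x)
    lem x = trans (*-identityʳ _) (trans (-1*x≈-x x) (-‿cong (sym (*-identityˡ x))))
  sgn-swap (suc i) zero = lem (sgn i)
    where
    lem : ∀ x → 1# * x ≈ - (((- 1#) * x) * 1#)
    lem x = begin
      1# * x                 ≈⟨ *-identityˡ x ⟩
      x                      ≈⟨ sym (-‿involutive x) ⟩
      - (- x)                ≈⟨ -‿cong (sym (trans (*-identityʳ _) (-1*x≈-x x))) ⟩
      - (((- 1#) * x) * 1#)  ∎
  sgn-swap (suc i) (suc k) = begin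
    ((- 1#) * sgn (punchIn i k)) * ((- 1#) * sgn (pinch k i))
      ≈⟨ lem₁ (sgn (punchIn i k)) (sgn (pinch k i)) ⟩
    sgn (punchIn i k) * sgn (pinch k i)    ≈⟨ sgn-swap i k ⟩
    - (sgn i * sgn k)                      ≈⟨ -‿cong (sym (lem₁ (sgn i) (sgn k))) ⟩
    - (((- 1#) * sgn i) * ((- 1#) * sgn k)) ∎
    where
    lem₁ : ∀ x y → ((- 1#) * x) * ((- 1#) * y) ≈ x * y
    lem₁ x y = begin
      ((- 1#) * x) * ((- 1#) * y)
        ≈⟨ solve 3 (λ m x y → (m :* x) :* (m :* y) := (m :* m) :* (x :* y)) refl (- 1#) x y ⟩
      ((- 1#) * (- 1#)) * (x * y)
        ≈⟨ *-congʳ (trans (-1*x≈-x (- 1#)) (-‿involutive 1#)) ⟩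
      1# * (x * y)
        ≈⟨ *-identityˡ _ ⟩
      x * y ∎

  ∑∑-cancel : (T : Fin (suc n) → Fin n → Carrier) →
              (∀ i k → T i k + T (punchIn i k) (pinch k i) ≈ 0#) →
              sum (λ i → sum (T i)) ≈ 0#
  ∑∑-cancel {zero}  T h = +-identityˡ 0#
  ∑∑-cancel {suc n} T h = begin
    sum (T zero) + sum (λ i → T (suc i) zero + sum (λ k → T (suc i) (suc k)))
      ≈⟨ +-congˡ (∑-distrib-+ (λ i → T (suc i) zero) (λ i → sum (λ k → T (suc i) (suc k)))) ⟩
    sum (T zero) + (sum (λ i → T (suc i) zero) + sum (λ i → sum (λ k → T (suc i) (suc k))))
      ≈⟨ sym (+-assoc _ _ _) ⟩
    (sum (T zero) + sum (λ i → T (suc i) zero)) + sum (λ i → sum (λ k → T (suc i) (suc k)))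
      ≈⟨ +-cong
           (trans (sym (∑-distrib-+ (T zero) (λ i → T (suc i) zero))) (∑-zero edge))
           (∑∑-cancel (λ i k → T (suc i) (suc k)) (λ i k → h (suc i) (suc k))) ⟩
    0# + 0#
      ≈⟨ +-identityˡ 0# ⟩
    0# ∎
    where
    edge : ∀ k → T zero k + T (suc k) zero ≈ 0#
    edge zero    = h zero zero
    edge (suc k) = h zero (suc k)

  expand² : (u w : Fin (suc (suc n)) → Carrier) (D : Fin (suc (suc n)) → Fin (suc n) → Carrier) →
            Fin (suc (suc n)) → Fin (suc n) → Carrier
  expand² u w D i k = sgn i * (u i * (sgn k * (w (punchIn i k) * D i k)))

  minor² : Matrix (suc (suc n)) (suc (suc n)) → Fin (suc (suc n)) → Fin (suc n) → Carrier
  minor² A i k = det (λ r s → A (punchIn i (punchIn k r)) (suc (suc s)))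

  det-expand² : (A : Matrix (suc (suc n)) (suc (suc n))) →
    det A ≈ sum (λ i → sum (expand² (λ r → A r zero) (λ r → A r (suc zero)) (minor² A) i))
  det-expand² {n} A = sum-cong-≋ λ i →
    trans (*-congˡ {sgn i} (*-distribˡ-sum (A i zero) (inner i)))
          (*-distribˡ-sum (sgn i) (λ k → A i zero * inner i k))
    where
    inner : Fin (suc (suc n)) → Fin (suc n) → Carrier
    inner i k = sgn k * (A (punchIn i k) (suc zero) * minor² A i k)

  expand²-swap : (u w : Fin (suc (suc n)) → Carrier) (A : Matrix (suc (suc n)) (suc (suc n))) →
    ∀ i k → expand² u w (minor² A) i k + expand² w u (minor² A) (punchIn i k) (pinch k i) ≈ 0#
  expand²-swap u w A i k = begin
    expand² u w (minor² A) i k + expand² w u (minor² A) (punchIn i k) (pinch k i)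
      ≈⟨ +-congˡ (*-congˡ (*-congˡ (*-congˡ (*-cong
           (reflexive (≡.cong u (punchIn-swap i k)))
           (det-cong λ r s → reflexive (≡.cong (λ t → A t (suc (suc s))) (punchIn² i k r))))))) ⟩
    sgn i * (u i * (sgn k * (w (punchIn i k) * D)))
      + sgn (punchIn i k) * (w (punchIn i k) * (sgn (pinch k i) * (u i * D)))
      ≈⟨ lem₁ (sgn i) (u i) (sgn k) (w (punchIn i k)) D (sgn (punchIn i k)) (sgn (pinch k i)) ⟩
    (sgn i * sgn k + sgn (punchIn i k) * sgn (pinch k i)) * (u i * (w (punchIn i k) * D))
      ≈⟨ *-congʳ (+-congˡ (sgn-swap i k)) ⟩
    (sgn i * sgn k + - (sgn i * sgn k)) * (u i * (w (punchIn i k) * D))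
      ≈⟨ *-congʳ (-‿inverseʳ _) ⟩
    0# * (u i * (w (punchIn i k) * D))
      ≈⟨ zeroˡ _ ⟩
    0# ∎
    where
    D = minor² A i k
    lem₁ : ∀ s x t y d s′ t′ → s * (x * (t * (y * d))) + s′ * (y * (t′ * (x * d)))
                             ≈ (s * t + s′ * t′) * (x * (y * d))
    lem₁ = solve 7 (λ s x t y d s′ t′ →
      s :* (x :* (t :* (y :* d))) :+ s′ :* (y :* (t′ :* (x :* d)))
        := (s :* t :+ s′ :* t′) :* (x :* (y :* d))) refl

  swap₀₁ : Matrix (suc (suc n)) (suc (suc n)) → Matrix (suc (suc n)) (suc (suc n))
  swap₀₁ A r zero          = A r (suc zero)
  swap₀₁ A r (suc zero)    = A r zero
  swap₀₁ A r (suc (suc s)) = A r (suc (suc s))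

  det-swap₀₁ : (A : Matrix (suc (suc n)) (suc (suc n))) → det A + det (swap₀₁ A) ≈ 0#
  det-swap₀₁ A = begin
    det A + det (swap₀₁ A)
      ≈⟨ +-cong (det-expand² A) (det-expand² (swap₀₁ A)) ⟩
    sum (λ i → sum (T i)) + sum (λ i → sum (T′ i))
      ≈⟨ sym (∑-distrib-+ (λ i → sum (T i)) (λ i → sum (T′ i))) ⟩
    sum (λ i → sum (T i) + sum (T′ i))
      ≈⟨ sum-cong-≋ (λ i → sym (∑-distrib-+ (T i) (T′ i))) ⟩
    sum (λ i → sum (λ k → T i k + T′ i k))
      ≈⟨ ∑∑-cancel (λ i k → T i k + T′ i k) cancel ⟩
    0# ∎
    where
    u = λ r → A r zero
    w = λ r → A r (suc zero)
    T  = expand² u w (minor² A)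
    T′ = expand² w u (minor² A)
    lem : ∀ p q r s → (p + q) + (r + s) ≈ (p + s) + (q + r)
    lem = solve 4 (λ p q r s → (p :+ q) :+ (r :+ s) := (p :+ s) :+ (q :+ r)) refl
    cancel : ∀ i k → (T i k + T′ i k) + (T (punchIn i k) (pinch k i) + T′ (punchIn i k) (pinch k i)) ≈ 0#
    cancel i k = begin
      (T i k + T′ i k) + (T (punchIn i k) (pinch k i) + T′ (punchIn i k) (pinch k i))
        ≈⟨ lem _ _ _ _ ⟩
      (T i k + T′ (punchIn i k) (pinch k i)) + (T′ i k + T (punchIn i k) (pinch k i))
        ≈⟨ +-cong (expand²-swap u w A i k) (expand²-swap w u A i k) ⟩
      0# + 0#
        ≈⟨ +-identityˡ 0# ⟩
      0# ∎

  det-alternating : (j : Fin n) (A : Matrix (suc n) (suc n)) →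
                    (∀ r → A r zero ≈ A r (suc j)) → det A ≈ 0#
  det-alternating zero A A₀≈A₁ = begin
    det A
      ≈⟨ det-expand² A ⟩
    sum (λ i → sum (expand² u (λ r → A r (suc zero)) (minor² A) i))
      ≈⟨ sum-cong-≋ (λ i → sum-cong-≋ (λ k →
           *-congˡ {sgn i} (*-congˡ {u i} (*-congˡ {sgn k} (*-congʳ {minor² A i k} (sym (A₀≈A₁ (punchIn i k)))))))) ⟩
    sum (λ i → sum (expand² u u (minor² A) i))
      ≈⟨ ∑∑-cancel (expand² u u (minor² A)) (expand²-swap u u A) ⟩
    0# ∎
    where u = λ r → A r zero
  det-alternating (suc j) A A₀≈Aⱼ = begin
    det A                    ≈⟨ sym (+-identityʳ _) ⟩
    det A + 0#               ≈⟨ +-congˡ (sym swapped≈0) ⟩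
    det A + det (swap₀₁ A)   ≈⟨ det-swap₀₁ A ⟩
    0#                       ∎
    where
    swapped≈0 : det (swap₀₁ A) ≈ 0#
    swapped≈0 = ∑-zero λ i → begin
      sgn i * (swap₀₁ A i zero * det (minor (swap₀₁ A) i))
        ≈⟨ *-congˡ (*-congˡ (det-alternating j (minor (swap₀₁ A) i) (λ r → A₀≈Aⱼ (punchIn i r)))) ⟩
      sgn i * (swap₀₁ A i zero * 0#)  ≈⟨ *-congˡ (zeroʳ _) ⟩
      sgn i * 0#                      ≈⟨ zeroʳ _ ⟩
      0#                              ∎

  addFirst : (Fin n → Carrier) → Matrix (suc n) (suc n) → Matrix (suc n) (suc n)
  addFirst t A r zero    = A r zero
  addFirst t A r (suc s) = A r (suc s) + t s * A r zero

  single : Fin n → Carrier → Fin n → Carrier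
  single zero    x zero    = x
  single zero    x (suc k) = 0#
  single (suc j) x zero    = 0#
  single (suc j) x (suc k) = single j x k

  single-≡ : (j : Fin n) (x : Carrier) → single j x j ≡ x
  single-≡ zero    x = ≡.refl
  single-≡ (suc j) x = single-≡ j x

  single-≢ : (j k : Fin n) (x : Carrier) → k ≢ j → single j x k ≡ 0#
  single-≢ zero    zero    x k≢j = ⊥-elim (k≢j ≡.refl)
  single-≢ zero    (suc k) x k≢j = ≡.refl
  single-≢ (suc j) zero    x k≢j = ≡.refl
  single-≢ (suc j) (suc k) x k≢j = single-≢ j k x (k≢j ∘ ≡.cong suc)

  ∑-single : (t : Fin n → Carrier) (k : Fin n) → sum (λ j → single j (t j) k) ≈ t k
  ∑-single t zero    = trans (+-congˡ (∑-zero {f = λ j → single (suc j) (t (suc j)) zero} λ _ → refl)) (+-identityʳ _)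
  ∑-single t (suc k) = trans (+-identityˡ _) (∑-single (t ∘ suc) k)

  det-addSingle : (j : Fin n) (x : Carrier) (A : Matrix (suc n) (suc n)) →
                  det (addFirst (single j x) A) ≈ det A
  det-addSingle {n} j x A = begin
    det (addFirst (single j x) A)  ≈⟨ det-linear (suc j) A (addFirst (single j x) A) C x changed same C-same ⟩
    det A + x * det C              ≈⟨ +-congˡ (*-congˡ (det-alternating j C C₀≈Cⱼ)) ⟩
    det A + x * 0#                 ≈⟨ +-congˡ (zeroʳ x) ⟩
    det A + 0#                     ≈⟨ +-identityʳ _ ⟩
    det A                          ∎
    where
    C : Matrix (suc n) (suc n)
    C r s = if does (s Fin.≟ suc j) then A r zero else A r s
    C-at : ∀ r → C r (suc j) ≈ A r zero
    C-at r with j Fin.≟ j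
    ... | yes _  = refl
    ... | no j≢j = ⊥-elim (j≢j ≡.refl)
    C-same : ∀ r s → s ≢ suc j → C r s ≈ A r s
    C-same r s s≢ with s Fin.≟ suc j
    ... | yes s≡ = ⊥-elim (s≢ s≡)
    ... | no _   = refl
    C₀≈Cⱼ : ∀ r → C r zero ≈ C r (suc j)
    C₀≈Cⱼ r = sym (C-at r)
    changed : ∀ r → addFirst (single j x) A r (suc j) ≈ A r (suc j) + x * C r (suc j)
    changed r = +-congˡ (*-cong (reflexive (single-≡ j x)) (sym (C-at r)))
    same : ∀ r s → s ≢ suc j → addFirst (single j x) A r s ≈ A r s
    same r zero    s≢ = refl
    same r (suc s) s≢ = begin
      A r (suc s) + single j x s * A r zero
        ≈⟨ +-congˡ (*-congʳ (reflexive (single-≢ j s x (s≢ ∘ ≡.cong suc)))) ⟩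
      A r (suc s) + 0# * A r zero  ≈⟨ +-congˡ (zeroˡ _) ⟩
      A r (suc s) + 0#             ≈⟨ +-identityʳ _ ⟩
      A r (suc s)                  ∎

  det-add∑ : (t : Fin m → Fin n → Carrier) →
             (∀ i (A : Matrix (suc n) (suc n)) → det (addFirst (t i) A) ≈ det A) →
             (A : Matrix (suc n) (suc n)) → det (addFirst (λ k → sum (λ i → t i k)) A) ≈ det A
  det-add∑ {zero} {n} t h A = det-cong same
    where
    same : ∀ r s → addFirst (λ k → 0#) A r s ≈ A r s
    same r zero    = refl
    same r (suc s) = trans (+-congˡ (zeroˡ _)) (+-identityʳ _)
  det-add∑ {suc m} {n} t h A = begin
    det (addFirst (λ k → t zero k + rest k) A)  ≈⟨ det-cong split ⟩
    det (addFirst (t zero) (addFirst rest A))   ≈⟨ h zero (addFirst rest A) ⟩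
    det (addFirst rest A)                       ≈⟨ det-add∑ (t ∘ suc) (h ∘ suc) A ⟩
    det A                                       ∎
    where
    rest : Fin n → Carrier
    rest k = sum (λ i → t (suc i) k)
    lem : ∀ a p q u → a + (p + q) * u ≈ (a + q * u) + p * u
    lem = solve 4 (λ a p q u → a :+ (p :+ q) :* u := (a :+ q :* u) :+ p :* u) refl
    split : ∀ r s → addFirst (λ k → t zero k + rest k) A r s ≈ addFirst (t zero) (addFirst rest A) r s
    split r zero    = refl
    split r (suc s) = lem (A r (suc s)) (t zero s) (rest s) (A r zero)

  det-addFirst : (t : Fin n → Carrier) (A : Matrix (suc n) (suc n)) → det (addFirst t A) ≈ det A
  det-addFirst {n} t A = trans (det-cong same)
    (det-add∑ (λ j → single j (t j)) (λ j → det-addSingle j (t j)) A)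
    where
    same : ∀ r s → addFirst t A r s ≈ addFirst (λ k → sum (λ j → single j (t j) k)) A r s
    same r zero    = refl
    same r (suc s) = +-congˡ (*-congʳ (sym (∑-single t s)))

  -- Univariate polynomials as lists of coefficients, constant term first.

  eval : List Carrier → Carrier → Carrier
  eval []      x = 0#
  eval (a ∷ f) x = a + x * eval f x

  quot : Carrier → List Carrier → List Carrier
  quot y []          = []
  quot y (a ∷ [])    = []
  quot y (a ∷ b ∷ f) = eval (b ∷ f) y ∷ quot y (b ∷ f)

  eval-quot : ∀ f x y → eval f x ≈ (x - y) * eval (quot y f) x + 1# * eval f y
  eval-quot []          x y = sym (trans (+-cong (zeroʳ _) (zeroʳ _)) (+-identityˡ 0#))
  eval-quot (a ∷ [])    x y =
    solve 4 (λ a x y d → a :+ x :* con 0 := d :* con 0 :+ con 1 :* (a :+ y :* con 0))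
      refl a x y (x - y)
  eval-quot (a ∷ f@(b ∷ g)) x y = begin
    a + x * eval f x
      ≈⟨ +-congˡ (*-congˡ (eval-quot f x y)) ⟩
    a + x * (d * q + 1# * e)
      ≈⟨ solve 5 (λ a x d q e → a :+ x :* (d :* q :+ con 1 :* e) := d :* (x :* q) :+ (a :+ x :* e))
           refl a x d q e ⟩
    d * (x * q) + (a + x * e)
      ≈⟨ +-congˡ (+-congˡ (*-congʳ (sym d+y≈x))) ⟩
    d * (x * q) + (a + (d + y) * e)
      ≈⟨ solve 6 (λ a x y d q e →
           d :* (x :* q) :+ (a :+ (d :+ y) :* e) := d :* (e :+ x :* q) :+ con 1 :* (a :+ y :* e))
           refl a x y d q e ⟩
    d * (e + x * q) + 1# * (a + y * e) ∎
    where
    d = x - y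
    q = eval (quot y f) x
    e = eval f y
    d+y≈x : d + y ≈ x
    d+y≈x = trans (+-assoc x (- y) y) (trans (+-congˡ (-‿inverseˡ y)) (+-identityʳ x))

  alternant : (Fin n → List Carrier) → (Fin n → Carrier) → Carrier
  alternant f x = det (λ i j → eval (f i) (x j))

  differences : (Fin (suc n) → Carrier) → Fin n → Carrier
  differences x j = x (suc j) - x zero

  Δ : (Fin n → Carrier) → Carrier
  Δ {zero}  x = 1#
  Δ {suc n} x = ∏ (differences x) * Δ (x ∘ suc)

  quots : (Fin (suc n) → List Carrier) → (Fin (suc n) → Carrier) → Fin (suc n) → Fin n → List Carrier
  quots f x i r = quot (x zero) (f (punchIn i r))

  alternant-step : (f : Fin (suc n) → List Carrier) (x : Fin (suc n) → Carrier) →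
    alternant f x ≈ ∏ (differences x) *
      sum (λ i → sgn i * (eval (f i) (x zero) * alternant (quots f x i) (x ∘ suc)))
  alternant-step {n} f x = begin
    alternant f x                         ≈⟨ det-cong entry ⟩
    det (addFirst (λ _ → 1#) B)           ≈⟨ det-addFirst (λ _ → 1#) B ⟩
    det B                                 ≈⟨ det-cong scaled ⟩
    det (λ i j → ρ j * Z i j)             ≈⟨ det-scale ρ Z ⟩
    (1# * ∏ (differences x)) * det Z      ≈⟨ *-congʳ (*-identityˡ _) ⟩
    ∏ (differences x) * det Z             ∎
    where
    Z B : Matrix (suc n) (suc n)
    Z i zero    = eval (f i) (x zero)
    Z i (suc j) = eval (quot (x zero) (f i)) (x (suc j))
    B i zero    = Z i zero
    B i (suc j) = differences x j * Z i (suc j)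
    ρ : Fin (suc n) → Carrier
    ρ zero    = 1#
    ρ (suc j) = differences x j
    entry : ∀ i j → eval (f i) (x j) ≈ addFirst (λ _ → 1#) B i j
    entry i zero    = refl
    entry i (suc j) = eval-quot (f i) (x (suc j)) (x zero)
    scaled : ∀ i j → B i j ≈ ρ j * Z i j
    scaled i zero    = sym (*-identityˡ _)
    scaled i (suc j) = refl

  Δ∣alternant : (f : Fin n → List Carrier) (x : Fin n → Carrier) → Δ x ∣ alternant f x
  Δ∣alternant {zero}  f x = 1# , *-identityˡ 1#
  Δ∣alternant {suc n} f x = sum (λ i → α i * q i) , (begin
    sum (λ i → α i * q i) * (∏ (differences x) * Δ (x ∘ suc))
      ≈⟨ lem (sum (λ i → α i * q i)) (∏ (differences x)) (Δ (x ∘ suc)) ⟩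
    ∏ (differences x) * (sum (λ i → α i * q i) * Δ (x ∘ suc))
      ≈⟨ *-congˡ (*-distribʳ-sum (Δ (x ∘ suc)) (λ i → α i * q i)) ⟩
    ∏ (differences x) * sum (λ i → (α i * q i) * Δ (x ∘ suc))
      ≈⟨ *-congˡ (sum-cong-≋ term) ⟩
    ∏ (differences x) *
      sum (λ i → sgn i * (eval (f i) (x zero) * alternant (quots f x i) (x ∘ suc)))
      ≈⟨ sym (alternant-step f x) ⟩
    alternant f x ∎)
    where
    α q : Fin (suc n) → Carrier
    α i = sgn i * eval (f i) (x zero)
    q i = _∣ʳ_.quotient (Δ∣alternant (quots f x i) (x ∘ suc))
    lem : ∀ s p d → s * (p * d) ≈ p * (s * d)
    lem = solve 3 (λ s p d → s :* (p :* d) := p :* (s :* d)) refl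
    term : ∀ i → (α i * q i) * Δ (x ∘ suc) ≈
                 sgn i * (eval (f i) (x zero) * alternant (quots f x i) (x ∘ suc))
    term i = begin
      (α i * q i) * Δ (x ∘ suc)  ≈⟨ *-assoc _ _ _ ⟩
      α i * (q i * Δ (x ∘ suc))  ≈⟨ *-congˡ (_∣ʳ_.equality (Δ∣alternant (quots f x i) (x ∘ suc))) ⟩
      α i * alternant (quots f x i) (x ∘ suc)  ≈⟨ *-assoc _ _ _ ⟩
      sgn i * (eval (f i) (x zero) * alternant (quots f x i) (x ∘ suc)) ∎

  data Monic : ℕ → List Carrier → Set (c ⊔ ℓ) where
    one  : ∀ {u} → u ≈ 1# → Monic 0 (u ∷ [])
    _∷ₘ_ : ∀ {d f} u → Monic d f → Monic (suc d) (u ∷ f)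

  eval-monic₀ : ∀ {f} x → Monic 0 f → eval f x ≈ 1#
  eval-monic₀ x (one u≈1) = trans (+-cong u≈1 (zeroʳ x)) (+-identityʳ 1#)

  quot-monic : ∀ {d f} y → Monic (suc d) f → Monic d (quot y f)
  quot-monic y (u ∷ₘ g@(one _))  = one (eval-monic₀ y g)
  quot-monic y (u ∷ₘ (w ∷ₘ g)) = _ ∷ₘ quot-monic y (w ∷ₘ g)

  eval-quot-monic₀ : ∀ {f} y x → Monic 0 f → eval (quot y f) x ≈ 0#
  eval-quot-monic₀ y x (one _) = refl

  alternant-monic : (f : Fin n → List Carrier) (x : Fin n → Carrier) →
                    (∀ i → Monic (toℕ i) (f i)) → alternant f x ≈ Δ x
  alternant-monic {zero}  f x monic = refl
  alternant-monic {suc n} f x monic = begin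
    alternant f x
      ≈⟨ alternant-step f x ⟩
    ∏ (differences x) *
      sum (λ i → sgn i * (eval (f i) (x zero) * alternant (quots f x i) (x ∘ suc)))
      ≈⟨ *-congˡ (+-cong first (∑-zero (rest f x (monic zero)))) ⟩
    ∏ (differences x) * (Δ (x ∘ suc) + 0#)
      ≈⟨ *-congˡ (+-identityʳ _) ⟩
    Δ x ∎
    where
    first : 1# * (eval (f zero) (x zero) * alternant (quots f x zero) (x ∘ suc)) ≈ Δ (x ∘ suc)
    first = begin
      1# * (eval (f zero) (x zero) * alternant (quots f x zero) (x ∘ suc))
        ≈⟨ *-identityˡ _ ⟩
      eval (f zero) (x zero) * alternant (quots f x zero) (x ∘ suc)
        ≈⟨ *-cong (eval-monic₀ (x zero) (monic zero))
             (alternant-monic (quots f x zero) (x ∘ suc) (λ i → quot-monic (x zero) (monic (suc i)))) ⟩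
      1# * Δ (x ∘ suc)
        ≈⟨ *-identityˡ _ ⟩
      Δ (x ∘ suc) ∎
    rest : ∀ {n} (f : Fin (suc n) → List Carrier) (x : Fin (suc n) → Carrier) → Monic 0 (f zero) →
           ∀ i → sgn (suc i) * (eval (f (suc i)) (x zero) * alternant (quots f x (suc i)) (x ∘ suc)) ≈ 0#
    rest {suc n} f x monic₀ i = begin
      sgn (suc i) * (eval (f (suc i)) (x zero) * alternant (quots f x (suc i)) (x ∘ suc))
        ≈⟨ *-congˡ (*-congˡ (det-zeroRow (λ r s → eval (quots f x (suc i) r) (x (suc s)))
             (λ s → eval-quot-monic₀ (x zero) (x (suc s)) monic₀))) ⟩
      sgn (suc i) * (eval (f (suc i)) (x zero) * 0#)  ≈⟨ *-congˡ (zeroʳ _) ⟩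
      sgn (suc i) * 0#                                ≈⟨ zeroʳ _ ⟩
      0#                                              ∎

  monomial : ℕ → List Carrier
  monomial zero    = 1# ∷ []
  monomial (suc e) = 0# ∷ monomial e

  eval-monomial : ∀ e x → eval (monomial e) x ≈ x ^ e
  eval-monomial zero    x = trans (+-congˡ (zeroʳ x)) (+-identityʳ 1#)
  eval-monomial (suc e) x = trans (+-identityˡ _) (*-congˡ (eval-monomial e x))

  monomial-monic : ∀ e → Monic e (monomial e)
  monomial-monic zero    = one refl
  monomial-monic (suc e) = 0# ∷ₘ monomial-monic e

  powers : (Fin n → ℕ) → (Fin n → Carrier) → Matrix n n
  powers e x i j = x j ^ e i

  vandermonde∣alternant : (e : Fin n → ℕ) (x : Fin n → Carrier) →
                          det (powers toℕ x) ∣ det (powers e x)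
  vandermonde∣alternant e x with Δ∣alternant (monomial ∘ e) x
  ... | q , q*Δ≈ = q , (begin
    q * det (powers toℕ x)          ≈⟨ *-congˡ (det-cong λ i j → sym (eval-monomial (toℕ i) (x j))) ⟩
    q * alternant (monomial ∘ toℕ) x ≈⟨ *-congˡ (alternant-monic (monomial ∘ toℕ) x (monomial-monic ∘ toℕ)) ⟩
    q * Δ x                         ≈⟨ q*Δ≈ ⟩
    alternant (monomial ∘ e) x      ≈⟨ det-cong (λ i j → eval-monomial (e i) (x j)) ⟩
    det (powers e x)                ∎)

------------------------------------------------------------------------
-- The polynomial ring ℤ[x₁, …, x_N]

-- The free commutative ring on N generators, as a setoid: terms modulo the
-- commutative ring axioms.

module Polynomial (N : ℕ) where

  infixl 6 _⊕_
  infixl 7 _⊗_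
  infix  8 ⊝_
  infix  4 _≋_

  data Poly : Set where
    var     : Fin N → Poly
    𝟘 𝟙     : Poly
    _⊕_ _⊗_ : Poly → Poly → Poly
    ⊝_      : Poly → Poly

  data _≋_ : Rel Poly Level.zero where
    ≋-refl     : ∀ {p} → p ≋ p
    ≋-sym      : ∀ {p q} → p ≋ q → q ≋ p
    ≋-trans    : ∀ {p q r} → p ≋ q → q ≋ r → p ≋ r
    ⊕-cong     : ∀ {p p′ q q′} → p ≋ p′ → q ≋ q′ → p ⊕ q ≋ p′ ⊕ q′
    ⊗-cong     : ∀ {p p′ q q′} → p ≋ p′ → q ≋ q′ → p ⊗ q ≋ p′ ⊗ q′
    ⊝-cong     : ∀ {p p′} → p ≋ p′ → ⊝ p ≋ ⊝ p′
    ⊕-assoc    : ∀ p q r → (p ⊕ q) ⊕ r ≋ p ⊕ (q ⊕ r)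
    ⊕-comm     : ∀ p q → p ⊕ q ≋ q ⊕ p
    ⊕-identity : ∀ p → 𝟘 ⊕ p ≋ p
    ⊝-inverse  : ∀ p → ⊝ p ⊕ p ≋ 𝟘
    ⊗-assoc    : ∀ p q r → (p ⊗ q) ⊗ r ≋ p ⊗ (q ⊗ r)
    ⊗-comm     : ∀ p q → p ⊗ q ≋ q ⊗ p
    ⊗-identity : ∀ p → 𝟙 ⊗ p ≋ p
    ⊗-distrib  : ∀ p q r → p ⊗ (q ⊕ r) ≋ p ⊗ q ⊕ p ⊗ r

  commutativeRing : CommutativeRing Level.zero Level.zero
  commutativeRing = record
    { Carrier = Poly
    ; _≈_ = _≋_
    ; _+_ = _⊕_
    ; _*_ = _⊗_
    ; -_ = ⊝_
    ; 0# = 𝟘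
    ; 1# = 𝟙
    ; isCommutativeRing = record
      { isRing = record
        { +-isAbelianGroup = record
          { isGroup = record
            { isMonoid = record
              { isSemigroup = record
                { isMagma = record { isEquivalence = ≋-isEquivalence ; ∙-cong = ⊕-cong }
                ; assoc = ⊕-assoc
                }
              ; identity = ⊕-identity , λ p → ≋-trans (⊕-comm p 𝟘) (⊕-identity p)
              }
            ; inverse = ⊝-inverse , λ p → ≋-trans (⊕-comm p (⊝ p)) (⊝-inverse p)
            ; ⁻¹-cong = ⊝-cong
            }
          ; comm = ⊕-comm
          }
        ; *-cong = ⊗-cong
        ; *-assoc = ⊗-assoc
        ; *-identity = ⊗-identity , λ p → ≋-trans (⊗-comm p 𝟙) (⊗-identity p)
        ; distrib = ⊗-distrib , λ p q r →
            ≋-trans (⊗-comm (q ⊕ r) p)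
              (≋-trans (⊗-distrib p q r) (⊕-cong (⊗-comm p q) (⊗-comm p r)))
        }
      ; *-comm = ⊗-comm
      }
    }
    where
    ≋-isEquivalence : IsEquivalence _≋_
    ≋-isEquivalence = record { refl = ≋-refl ; sym = ≋-sym ; trans = ≋-trans }

  module Evaluation (R : CommutativeRing c ℓ) (x : Fin N → CommutativeRing.Carrier R) where

    open CommutativeRing R

    ⟦_⟧ : Poly → Carrier
    ⟦ var i ⟧ = x i
    ⟦ 𝟘 ⟧     = 0#
    ⟦ 𝟙 ⟧     = 1#
    ⟦ p ⊕ q ⟧ = ⟦ p ⟧ + ⟦ q ⟧
    ⟦ p ⊗ q ⟧ = ⟦ p ⟧ * ⟦ q ⟧
    ⟦ ⊝ p ⟧   = - ⟦ p ⟧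

    ⟦⟧-cong : ∀ {p q} → p ≋ q → ⟦ p ⟧ ≈ ⟦ q ⟧
    ⟦⟧-cong ≋-refl             = refl
    ⟦⟧-cong (≋-sym e)          = sym (⟦⟧-cong e)
    ⟦⟧-cong (≋-trans e e′)     = trans (⟦⟧-cong e) (⟦⟧-cong e′)
    ⟦⟧-cong (⊕-cong e e′)      = +-cong (⟦⟧-cong e) (⟦⟧-cong e′)
    ⟦⟧-cong (⊗-cong e e′)      = *-cong (⟦⟧-cong e) (⟦⟧-cong e′)
    ⟦⟧-cong (⊝-cong e)         = -‿cong (⟦⟧-cong e)
    ⟦⟧-cong (⊕-assoc p q r)    = +-assoc ⟦ p ⟧ ⟦ q ⟧ ⟦ r ⟧
    ⟦⟧-cong (⊕-comm p q)       = +-comm ⟦ p ⟧ ⟦ q ⟧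
    ⟦⟧-cong (⊕-identity p)     = +-identityˡ ⟦ p ⟧
    ⟦⟧-cong (⊝-inverse p)      = -‿inverseˡ ⟦ p ⟧
    ⟦⟧-cong (⊗-assoc p q r)    = *-assoc ⟦ p ⟧ ⟦ q ⟧ ⟦ r ⟧
    ⟦⟧-cong (⊗-comm p q)       = *-comm ⟦ p ⟧ ⟦ q ⟧
    ⟦⟧-cong (⊗-identity p)     = *-identityˡ ⟦ p ⟧
    ⟦⟧-cong (⊗-distrib p q r)  = distribˡ ⟦ p ⟧ ⟦ q ⟧ ⟦ r ⟧

------------------------------------------------------------------------
-- Partial Schur functions

elements : (p : Subset m) → Vec (Fin m) ∣ p ∣
elements []            = []
elements (inside  ∷ p) = zero ∷ Vec.map suc (elements p)
elements (outside ∷ p) = Vec.map suc (elements p)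

module Schur (N : ℕ) where

  open Polynomial N
  open CommutativeRing commutativeRing using (*-commutativeMonoid; *-rawMagma)
  open CommutativeMonoidSum *-commutativeMonoid using () renaming (sum to ∏)
  open RawMagmaDefinitions *-rawMagma using (_∣_; module _∣ʳ_)
  open Determinant commutativeRing
  open Alternant commutativeRing using (vandermonde∣alternant)

  variables : (J : Subset N) → Fin ∣ J ∣ → Poly
  variables J j = var (lookup (elements J) j)

  -- With 0-based i, the index d-i+1 of the 1-based formula is
  -- opposite i.
  exponents : {d : ℕ} → Vec ℕ d → Fin d → ℕ
  exponents λs i = toℕ i ℕ.+ lookup λs (opposite i)

  numerator : (J : Subset N) → Vec ℕ ∣ J ∣ → Matrix ∣ J ∣ ∣ J ∣
  numerator J λs i j = variables J j ^ exponents λs i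
    where open SemiringExp (CommutativeRing.semiring commutativeRing) using (_^_)

  denominator : (J : Subset N) → Matrix ∣ J ∣ ∣ J ∣
  denominator J i j = variables J j ^ toℕ i
    where open SemiringExp (CommutativeRing.semiring commutativeRing) using (_^_)

  denominator∣numerator : (J : Subset N) (λs : Vec ℕ ∣ J ∣) → det (denominator J) ∣ det (numerator J λs)
  denominator∣numerator J λs = vandermonde∣alternant (exponents λs) (variables J)

  -- The quotient is unique, since ℤ[x₁, …, x_N] is an integral domain and
  -- the Vandermonde determinant is nonzero.
  schur : (J : Subset N) → Vec ℕ ∣ J ∣ → Poly
  schur J λs = _∣ʳ_.quotient (denominator∣numerator J λs)

  partialSchur : (P : Fin n → Subset N) → ((i : Fin n) → Vec ℕ ∣ P i ∣) → Poly
  partialSchur P Λ = ∏ (λ i → schur (P i) (Λ i))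

------------------------------------------------------------------------
-- Words

-- {v}ᵢ, so that ∣ positions v i ∣ is the number cᵢ of occurrences of sᵢ.
positions : Vec (Fin n) N → Fin n → Subset N
positions v i = tabulate (λ j → does (lookup v j Fin.≟ i))

occurrences : Vec (Fin n) N → Fin n → ℕ
occurrences v i = ∣ positions v i ∣

inversions : Vec (Fin n) N → ℕ
inversions {N = N} v = length (List.filter inversion? (List.cartesianProduct (List.allFin N) (List.allFin N)))
  where
  inversion? : (p : Fin N × Fin N) →
               Dec (proj₁ p Fin.< proj₂ p × lookup v (proj₂ p) Fin.< lookup v (proj₁ p))
  inversion? (a , b) = (a Fin.<? b) ×-dec (lookup v b Fin.<? lookup v a)

σ : Vec (Fin n) N → ℤ
σ v = -1ℤ ℤ.^ inversions v

------------------------------------------------------------------------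
-- Subsets of S × {0, …, ν-1}

module Counting where

  open CommutativeMonoidSum ℕ.+-0-commutativeMonoid
  open ≡.≡-Reasoning

  indicator : Bool → ℕ
  indicator b = if b then 1 else 0

  ∣p∣≡∑ : (p : Subset m) → ∣ p ∣ ≡ sum (λ j → indicator (lookup p j))
  ∣p∣≡∑ []            = ≡.refl
  ∣p∣≡∑ (inside  ∷ p) = ≡.cong suc (∣p∣≡∑ p)
  ∣p∣≡∑ (outside ∷ p) = ∣p∣≡∑ p

  ∣tabulate∣≡∑ : (f : Fin m → Bool) → ∣ tabulate f ∣ ≡ sum (λ j → indicator (f j))
  ∣tabulate∣≡∑ f = ≡.trans (∣p∣≡∑ (tabulate f))
    (sum-cong-≗ λ j → ≡.cong indicator (Vec.lookup∘tabulate f j))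

  ∑-+ : ∀ m (g : Fin (m ℕ.+ k) → ℕ) → sum g ≡ sum (λ i → g (i ↑ˡ k)) ℕ.+ sum (λ j → g (m ↑ʳ j))
  ∑-+ zero    g = ≡.refl
  ∑-+ (suc m) g = ≡.trans (≡.cong (g zero ℕ.+_) (∑-+ m (g ∘ suc))) (≡.sym (ℕ.+-assoc (g zero) _ _))

  ∑-combine : ∀ n (g : Fin (n ℕ.* ν) → ℕ) → sum g ≡ sum {n} (λ i → sum (λ k → g (combine i k)))
  ∑-combine         zero    g = ≡.refl
  ∑-combine {ν = ν} (suc n) g =
    ≡.trans (∑-+ ν g) (≡.cong (sum (λ k → g (k ↑ˡ (n ℕ.* ν))) ℕ.+_) (∑-combine n (g ∘ (ν ↑ʳ_))))

  ∑-≟ : (j : Fin n) → sum (λ i → indicator (does (j Fin.≟ i))) ≡ 1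
  ∑-≟ {suc n} zero    = ≡.cong suc (sum-replicate-zero n)
  ∑-≟ {suc n} (suc j) = ∑-≟ j

  ∑-1 : ∀ N → sum {N} (λ _ → 1) ≡ N
  ∑-1 zero    = ≡.refl
  ∑-1 (suc N) = ≡.cong suc (∑-1 N)

  ∑-occurrences : (v : Vec (Fin n) N) → sum (occurrences v) ≡ N
  ∑-occurrences {n} {N} v = begin
    sum (occurrences v)
      ≡⟨ sum-cong-≗ (λ i → ∣tabulate∣≡∑ (λ j → does (lookup v j Fin.≟ i))) ⟩
    sum {n} (λ i → sum {N} (λ j → indicator (does (lookup v j Fin.≟ i))))
      ≡⟨ ∑-comm (λ i j → indicator (does (lookup v j Fin.≟ i))) ⟩
    sum {N} (λ j → sum {n} (λ i → indicator (does (lookup v j Fin.≟ i))))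
      ≡⟨ sum-cong-≗ (λ j → ∑-≟ (lookup v j)) ⟩
    sum {N} (λ _ → 1)
      ≡⟨ ∑-1 N ⟩
    N ∎

module Minors {n N : ℕ} (v : Vec (Fin n) N) (ν : ℕ) where

  -- The pair (sᵢ , k) is encoded as combine i k : Fin (n * ν); the order of
  -- Fin (n * ν) is then the lexicographic order of pairs.
  fibre : Subset (n ℕ.* ν) → Fin n → Subset ν
  fibre 𝔷 i = tabulate (λ k → lookup 𝔷 (combine i k))

  _∈ℨ : Subset (n ℕ.* ν) → Set
  𝔷 ∈ℨ = ∀ i → ∣ fibre 𝔷 i ∣ ≡ occurrences v i

  _∈ℨ? : (𝔷 : Subset (n ℕ.* ν)) → Dec (𝔷 ∈ℨ)
  𝔷 ∈ℨ? = Fin.all? (λ i → ∣ fibre 𝔷 i ∣ ℕ.≟ occurrences v i)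

  ∣𝔷∣≡N : (𝔷 : Subset (n ℕ.* ν)) → 𝔷 ∈ℨ → ∣ 𝔷 ∣ ≡ N
  ∣𝔷∣≡N 𝔷 𝔷∈ℨ = begin
    ∣ 𝔷 ∣
      ≡⟨ ∣p∣≡∑ 𝔷 ⟩
    sum (λ q → indicator (lookup 𝔷 q))
      ≡⟨ ∑-combine n (λ q → indicator (lookup 𝔷 q)) ⟩
    sum {n} (λ i → sum (λ k → indicator (lookup 𝔷 (combine i k))))
      ≡⟨ sum-cong-≗ (λ (i : Fin n) → ≡.sym (∣tabulate∣≡∑ (λ k → lookup 𝔷 (combine i k)))) ⟩
    sum (λ i → ∣ fibre 𝔷 i ∣)
      ≡⟨ sum-cong-≗ 𝔷∈ℨ ⟩
    sum (occurrences v)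
      ≡⟨ ∑-occurrences v ⟩
    N ∎
    where
    open Counting
    open CommutativeMonoidSum ℕ.+-0-commutativeMonoid using (sum; sum-cong-≗)
    open ≡.≡-Reasoning

  -- Position j (0-based) in the decreasing list of second coordinates has
  -- cᵢ - (j + 1) subtracted.  The subtraction never truncates, because the
  -- list consists of cᵢ distinct naturals in decreasing order.
  Λ : (𝔷 : Subset (n ℕ.* ν)) → 𝔷 ∈ℨ → (i : Fin n) → Vec ℕ (occurrences v i)
  Λ 𝔷 𝔷∈ℨ i = tabulate (λ j → lookup decreasing j ℕ.∸ (occurrences v i ℕ.∸ suc (toℕ j)))
    where
    decreasing : Vec ℕ (occurrences v i)
    decreasing = Vec.reverse (Vec.cast (𝔷∈ℨ i) (Vec.map toℕ (elements (fibre 𝔷 i))))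

------------------------------------------------------------------------
-- The real numbers

record OrderedField c ℓ₁ ℓ₂ : Set (lsuc (c ⊔ ℓ₁ ⊔ ℓ₂)) where
  field
    commutativeRing : CommutativeRing c ℓ₁
  open CommutativeRing commutativeRing public
  infix 4 _<_
  field
    _<_                : Rel Carrier ℓ₂
    isStrictTotalOrder : IsStrictTotalOrder _≈_ _<_
    1≉0                : ¬ 1# ≈ 0#
    *-inverse          : ∀ x → ¬ x ≈ 0# → ∃[ y ] x * y ≈ 1#
    +-mono-<           : ∀ {x y} z → x < y → x + z < y + z
    *-positive         : ∀ {x y} → 0# < x → 0# < y → 0# < x * y
  open IsStrictTotalOrder isStrictTotalOrder public using (compare)

  sign : Carrier → ℤ
  sign x with compare x 0#
  ... | tri< _ _ _ = -1ℤ
  ... | tri≈ _ _ _ = 0ℤ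
  ... | tri> _ _ _ = 1ℤ

-- ℝ is the Dedekind-complete ordered field, unique up to isomorphism.
record RealNumbers c ℓ₁ ℓ₂ : Set (lsuc (c ⊔ ℓ₁ ⊔ ℓ₂)) where
  field
    orderedField : OrderedField c ℓ₁ ℓ₂
  open OrderedField orderedField public

  IsUpperBound : (Carrier → Set (c ⊔ ℓ₁ ⊔ ℓ₂)) → Carrier → Set (c ⊔ ℓ₁ ⊔ ℓ₂)
  IsUpperBound A u = ∀ x → A x → ¬ u < x

  field
    supremum : (A : Carrier → Set (c ⊔ ℓ₁ ⊔ ℓ₂)) → ∃ A → ∃ (IsUpperBound A) →
               ∃[ s ] IsUpperBound A s × (∀ u → IsUpperBound A u → ¬ u < s)

------------------------------------------------------------------------
-- Parameter tensors, the model matrix and minors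

module Model (ℝ : RealNumbers c ℓ₁ ℓ₂) where

  open RealNumbers ℝ hiding (zero)
  open SemiringSum semiring using (sum; sum-syntax)
  open SemiringExp semiring using (_^_)
  open Determinant commutativeRing public using (Matrix; det)

  ParameterTensor : (N n ν : ℕ) → Set c
  ParameterTensor N n ν = Fin N → Fin n → Fin ν → Carrier

  modelMatrix : Vec (Fin n) N → ParameterTensor N n ν → (Fin N → Carrier) → Matrix N N
  modelMatrix {ν = ν} v 𝒫 x i l = ∑[ k < ν ] (𝒫 i (lookup v l) k * x l ^ toℕ k)

  asMatrix : ParameterTensor N n ν → Matrix N (n ℕ.* ν)
  asMatrix {ν = ν} 𝒫 i q = uncurry (𝒫 i) (remQuot ν q)

  columns : Matrix N m → (𝔷 : Subset m) → ∣ 𝔷 ∣ ≡ N → Matrix N N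
  columns A 𝔷 ∣𝔷∣≡N i j = A i (lookup (elements 𝔷) (Fin.cast (≡.sym ∣𝔷∣≡N) j))

  ∑⊆ : (Subset m → Carrier) → Carrier
  ∑⊆ {zero}  f = f []
  ∑⊆ {suc m} f = ∑⊆ (λ p → f (outside ∷ p)) + ∑⊆ (λ p → f (inside ∷ p))

  restrict : {A : Set} → Dec A → (A → Carrier) → Carrier
  restrict (yes a) f = f a
  restrict (no _)  f = 0#

  minorSchurSum : Vec (Fin n) N → ParameterTensor N n ν → (Fin N → Carrier) → Carrier
  minorSchurSum {N = N} {ν = ν} v 𝒫 x = ∑⊆ λ 𝔷 → restrict (𝔷 ∈ℨ?) λ 𝔷∈ℨ →
    det (columns (asMatrix 𝒫) 𝔷 (∣𝔷∣≡N 𝔷 𝔷∈ℨ)) * ⟦ partialSchur (positions v) (Λ 𝔷 𝔷∈ℨ) ⟧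
    where
    open Minors v ν
    open Polynomial.Evaluation N commutativeRing x
    open Schur N

------------------------------------------------------------------------
-- Coxeter systems

record CoxeterMatrix (n : ℕ) : Set where
  field
    order         : Fin n → Fin n → ℕ      -- 0 encodes ∞
    symmetric     : ∀ i j → order i j ≡ order j i
    diagonal      : ∀ i → order i i ≡ 1
    off-diagonal  : ∀ i j → i ≢ j → order i j ≢ 1

  -- The congruence on words generated by (sᵢ sⱼ)^mᵢⱼ = 1.  As mᵢᵢ = 1, the
  -- letters are involutions, so the quotient monoid is the group with this
  -- presentation.
  infix 4 _∼_
  data _∼_ : Rel (List (Fin n)) Level.zero where
    relation : ∀ i j → List.concat (List.replicate (order i j) (i ∷ j ∷ [])) ∼ []
    ++-cong  : ∀ {u u′ w w′} → u ∼ u′ → w ∼ w′ → u ++ w ∼ u′ ++ w′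
    ∼-refl   : ∀ {u} → u ∼ u
    ∼-sym    : ∀ {u w} → u ∼ w → w ∼ u
    ∼-trans  : ∀ {u w t} → u ∼ w → w ∼ t → u ∼ t

  Edge : Rel (Fin n) Level.zero
  Edge i j = i ≢ j × order i j ≢ 2

record CoxeterSystem a ℓ : Set (lsuc (a ⊔ ℓ)) where
  field
    W             : Group a ℓ
    rank          : ℕ
    generator     : Fin rank → Group.Carrier W
    coxeterMatrix : CoxeterMatrix rank
  open Group W using (Carrier; _≈_; _∙_; ε; setoid)
  open CoxeterMatrix coxeterMatrix using (_∼_; Edge)

  evaluate : List (Fin rank) → Carrier
  evaluate = List.foldr (λ i w → generator i ∙ w) ε

  field
    generated : ∀ w → ∃[ u ] evaluate u ≈ w
    presented : ∀ u u′ → evaluate u ≈ evaluate u′ ⇔ u ∼ u′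

  Finite : Set (a ⊔ ℓ)
  Finite = ∃[ k ] Inverse (≡.setoid (Fin k)) setoid

  Irreducible : Set
  Irreducible = NonZero rank × (∀ i j → Star Edge i j)

  IsLength : Carrier → ℕ → Set ℓ
  IsLength w k = (∃[ u ] evaluate u ≈ w × length u ≡ k) × (∀ u → evaluate u ≈ w → k ℕ.≤ length u)

  IsLongest : Carrier → ℕ → Set (a ⊔ ℓ)
  IsLongest w∘ N = IsLength w∘ N × (∀ w k → IsLength w k → k ℕ.≤ N)

  -- Membership in ℛ(w) when N is the length of w.
  IsReducedWord : Carrier → Vec (Fin rank) N → Set ℓ
  IsReducedWord w v = evaluate (toList v) ≈ w

  IsMaxOccurrences : Carrier → (N ν : ℕ) → Set ℓ
  IsMaxOccurrences w N ν =
    (∃[ v ] IsReducedWord {N} w v × ∃[ i ] occurrences v i ≡ ν) ×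
    (∀ v → IsReducedWord {N} w v → ∀ i → occurrences v i ℕ.≤ ν)

{-# OPTIONS --safe #-}
module Submission where

-- The model matrix factors as 𝒫 X, where the rows of X are indexed by pairs
-- (s , k) and its entry in column l is x_l ^ k if v_l = s and 0 otherwise.
-- By the Cauchy-Binet formula det M is the sum over 𝔷 of det [𝒫]_𝔷 det X_𝔷.
-- Sorting the columns of X_𝔷 by their letters costs the sign σ(v) and makes
-- X_𝔷 block diagonal; its blocks are square only if 𝔷 ∈ ℨ, and then they
-- are generalised Vandermonde matrices, so that
--   det X_𝔷 = σ(v) V S_Λ,   V = the product over s of Vandermonde(x_l : v_l = s).
-- The factor V does not depend on 𝔷 and is positive.
--
-- Determinants are expanded over lists of row and column labels, which need
-- not have equal lengths: the contributions of 𝔷 ∉ ℨ then vanish by themselves.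

open import Algebra.Bundles using (CommutativeRing; Group)
import Algebra.Definitions.RawMagma as RawMagmaDefinitions
import Algebra.Properties.CommutativeMonoid.Sum as CommutativeMonoidSum
import Algebra.Properties.CommutativeSemigroup as CommutativeSemigroupProperties
import Algebra.Properties.Ring as RingProperties
import Algebra.Properties.Semiring.Exp as SemiringExp
import Algebra.Properties.Semiring.Sum as SemiringSum
import Algebra.Solver.Ring.NaturalCoefficients.Default as SemiringSolver
open import Data.Bool.Base using (Bool; true; false; not; T; if_then_else_; _∧_)
open import Data.Empty using (⊥-elim)
open import Data.Fin.Base as Fin
  using (Fin; zero; suc; toℕ; combine; remQuot; opposite; punchIn; inject₁; fromℕ; _↑ˡ_; _↑ʳ_)
import Data.Fin.Properties as Fin
open import Data.Fin.Subset using (Subset; inside; outside; ∣_∣)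
open import Data.Integer.Base as ℤ using (0ℤ; 1ℤ; -1ℤ)
import Data.Integer.Properties as ℤ
open import Data.List.Base as List using (List; []; _∷_; _++_; length; map; filterᵇ)
import Data.List.Properties as List
open import Data.List.Relation.Unary.All as All using (All; []; _∷_)
import Data.List.Relation.Unary.All.Properties as All
open import Data.List.Relation.Unary.AllPairs using (AllPairs; []; _∷_)
import Data.List.Relation.Unary.AllPairs.Properties as AllPairs
open import Data.Nat.Base as ℕ using (ℕ; zero; suc)
import Data.Nat.Properties as ℕ
open import Data.Product.Base using (∃; _×_; _,_; proj₁; proj₂; map₁; uncurry)
open import Data.Vec.Base as Vec using (Vec; []; _∷_; lookup; toList)
import Data.Vec.Properties as Vec
open import Function.Base using (_∘_; id)
open import Level using (Level)
open import Relation.Binary.Definitions using (tri<; tri≈; tri>)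
open import Relation.Binary.PropositionalEquality as ≡ using (_≡_; _≢_)
import Relation.Binary.Reasoning.Setoid as SetoidReasoning
open import Relation.Binary.Structures using (IsStrictTotalOrder)
open import Relation.Nullary.Decidable using (Dec; yes; no; does; T?)
open import Relation.Nullary.Negation using (¬_)

open import Defs

-- No permutation of columns is ever carried out. With the rows of the least letter in front,
-- Laplace expansion along those rows pulls out the columns of that letter, and the sign of this
-- step counts the pairs in which a larger letter precedes the least one: these are the inversions
-- that involve the least letter. Recursion on the remaining letters collects all of inv(v).
-- Cauchy-Binet is an induction on the pairs (s , k), since one more pair is a rank-one update of
-- the product 𝒫 X. The Schur polynomial is available only as a quotient in a formal polynomial
-- ring. It enters through the identity quotient times denominator equals numerator, which
-- evaluation carries to the real points. There the denominator is a product of differences x_j -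
-- x_i over positions i < j of the same letter, and the monotonicity hypothesis makes each of them
-- positive.

private
  module ℕ+ = CommutativeSemigroupProperties ℕ.+-commutativeSemigroup

  variable
    a b c ℓ ℓ₁ ℓ₂ : Level
    A A′ B C E : Set a
    m n N ν : ℕ

-- Inversions of a word, split off letter by letter

module Splitting {B : Set b} (P : B → Bool) where

  inP outP : List B → List B
  inP  = filterᵇ P
  outP = filterᵇ (not ∘ P)

  -- The inversions undone by moving the members of P to the front.
  crossings : List B → ℕ
  crossings []       = 0
  crossings (x ∷ xs) = (if P x then 0 else length (inP xs)) ℕ.+ crossings xs

concatTabulate : (Fin n → List A) → List A
concatTabulate K = List.concat (List.tabulate K)

taggedRows : (Fin m → List A) → List (Fin m × A)
taggedRows K = concatTabulate (λ i → map (i ,_) (K i))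

-- This is the shape, one block of rows followed by another, that `detᴸ-blocks` takes.
taggedRows-suc : (K : Fin (suc m) → List A) →
                 taggedRows K ≡ map (zero ,_) (K zero) ++ map (map₁ suc) (taggedRows (K ∘ suc))
taggedRows-suc K = ≡.cong (map (zero ,_) (K zero) ++_) (≡.sym (≡.trans
  (≡.sym (List.concat-map (List.tabulate λ i → map (i ,_) (K (suc i)))))
  (≡.cong List.concat (≡.trans (List.map-tabulate _ (map (map₁ suc)))
    (List.tabulate-cong λ i → ≡.sym (List.map-∘ (K (suc i))))))))

module Word {B : Set b} (v : B → Fin n) where

  isLetter : Fin n → B → Bool
  isLetter s x = does (v x Fin.≟ s)

  -- Written with `ℕ.<ᵇ`, it agrees by computation with the decision made inside `inversions`.
  isBelow : B → B → Bool
  isBelow x y = toℕ (v y) ℕ.<ᵇ toℕ (v x)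

  isBelow-true : ∀ x y → isBelow x y ≡ true → v y Fin.< v x
  isBelow-true x y eq = ℕ.<ᵇ⇒< _ _ (≡.subst T (≡.sym eq) _)

  isBelow-false : ∀ x y → isBelow x y ≡ false → ¬ v y Fin.< v x
  isBelow-false x y eq lt = ≡.subst T eq (ℕ.<⇒<ᵇ lt)

  inv : List B → ℕ
  inv []       = 0
  inv (x ∷ xs) = length (filterᵇ (isBelow x) xs) ℕ.+ inv xs

  isLetter-true : ∀ s x → isLetter s x ≡ true → v x ≡ s
  isLetter-true s x eq with v x Fin.≟ s
  isLetter-true s x eq | yes p = p
  isLetter-true s x () | no _

  isLetter-false : ∀ s x → isLetter s x ≡ false → v x ≢ s
  isLetter-false s x eq with v x Fin.≟ s
  isLetter-false s x () | yes p
  isLetter-false s x eq | no ¬p = ¬p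

  module _ (s : Fin n) where

    open Splitting (isLetter s)

    below-least : ∀ x → v x ≡ s → ∀ xs → All (λ y → s Fin.≤ v y) xs →
                  length (filterᵇ (isBelow x) xs) ≡ 0
    below-least x vx≡s []       []         = ≡.refl
    below-least x vx≡s (y ∷ ys) (s≤ ∷ s≤s) with isBelow x y in eq
    ... | true  = ⊥-elim (ℕ.<⇒≱ (isBelow-true x y eq) (≡.subst (λ t → t Fin.≤ v y) (≡.sym vx≡s) s≤))
    ... | false = below-least x vx≡s ys s≤s

    -- Every occurrence of `s` behind `x` is inverted with `x`, whose letter is larger.
    below-split : ∀ x → s Fin.< v x → ∀ xs →
                  length (filterᵇ (isBelow x) xs) ≡
                  length (inP xs) ℕ.+ length (filterᵇ (isBelow x) (outP xs))
    below-split x s<vx []       = ≡.refl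
    below-split x s<vx (y ∷ ys) with v y Fin.≟ s
    below-split x s<vx (y ∷ ys) | yes vy≡s with isBelow x y in eq
    ... | true  = ≡.cong suc (below-split x s<vx ys)
    ... | false = ⊥-elim (isBelow-false x y eq (≡.subst (Fin._< v x) (≡.sym vy≡s) s<vx))
    below-split x s<vx (y ∷ ys) | no _ with isBelow x y in eq
    ... | true  = ≡.trans (≡.cong suc (below-split x s<vx ys)) (≡.sym (ℕ.+-suc (length (inP ys)) _))
    ... | false = below-split x s<vx ys

    -- A least letter is inverted with nothing behind it and with every larger letter in front of
    -- it; `crossings` counts the latter pairs, and all other inversions survive in `outP xs`.
    inv-split : ∀ xs → All (λ y → s Fin.≤ v y) xs → inv xs ≡ crossings xs ℕ.+ inv (outP xs)
    inv-split []       []         = ≡.refl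
    inv-split (x ∷ xs) (s≤ ∷ s≤s) with v x Fin.≟ s
    ... | yes vx≡s = ≡.cong₂ ℕ._+_ (below-least x vx≡s xs s≤s) (inv-split xs s≤s)
    ... | no  vx≢s = ≡.trans
      (≡.cong₂ ℕ._+_ (below-split x (ℕ.≤∧≢⇒< s≤ λ eq → vx≢s (≡.sym (Fin.toℕ-injective eq))) xs) (inv-split xs s≤s))
      (ℕ+.interchange (length (inP xs)) _ _ _)

    filter-outP : ∀ t → s ≢ t → ∀ xs → filterᵇ (isLetter t) (outP xs) ≡ filterᵇ (isLetter t) xs
    filter-outP t s≢t []       = ≡.refl
    filter-outP t s≢t (x ∷ xs) with v x Fin.≟ s
    filter-outP t s≢t (x ∷ xs) | yes vx≡s with v x Fin.≟ t
    ... | yes vx≡t = ⊥-elim (s≢t (≡.trans (≡.sym vx≡s) vx≡t))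
    ... | no _     = filter-outP t s≢t xs
    filter-outP t s≢t (x ∷ xs) | no _ with v x Fin.≟ t
    ... | yes _ = ≡.cong (x ∷_) (filter-outP t s≢t xs)
    ... | no _  = filter-outP t s≢t xs

    outP-letters : (ρ : Fin (suc m) → Fin n) → ρ zero ≡ s → ∀ xs → All (λ x → ∃ λ i → v x ≡ ρ i) xs →
                   All (λ x → ∃ λ i → v x ≡ ρ (suc i)) (outP xs)
    outP-letters ρ ρ0≡s []       []       = []
    outP-letters ρ ρ0≡s (x ∷ xs) (p ∷ ps) with v x Fin.≟ s | p
    ... | yes _   | _            = outP-letters ρ ρ0≡s xs ps
    ... | no vx≢s | zero  , vx≡  = ⊥-elim (vx≢s (≡.trans vx≡ ρ0≡s))
    ... | no _    | suc i , vx≡  = (i , vx≡) ∷ outP-letters ρ ρ0≡s xs ps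

-- Element lists of subsets, and exponents of the Schur numerators

toList-tabulate : (xs : Vec A n) → toList xs ≡ List.tabulate (lookup xs)
toList-tabulate []       = ≡.refl
toList-tabulate (x ∷ xs) = ≡.cong (x ∷_) (toList-tabulate xs)

tabulate-cast : ∀ {m N} (eq : m ≡ N) (xs : Vec A m) →
                List.tabulate (λ j → lookup xs (Fin.cast (≡.sym eq) j)) ≡ toList xs
tabulate-cast ≡.refl xs = ≡.trans (List.tabulate-cong λ j → ≡.cong (lookup xs) (Fin.cast-is-id ≡.refl j))
  (≡.sym (toList-tabulate xs))

tabulate-↑ : ∀ m (h : Fin (m ℕ.+ n) → A) →
             List.tabulate h ≡ List.tabulate (h ∘ (_↑ˡ n)) ++ List.tabulate (h ∘ (m ↑ʳ_))
tabulate-↑ zero    h = ≡.refl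
tabulate-↑ (suc m) h = ≡.cong (h zero ∷_) (tabulate-↑ m (h ∘ suc))

tabulate-combine : ∀ n (h : Fin (n ℕ.* ν) → A) →
                   List.tabulate h ≡ concatTabulate (λ s → List.tabulate (h ∘ combine {n} s))
tabulate-combine         zero    h = ≡.refl
tabulate-combine {ν = ν} (suc n) h =
  ≡.trans (tabulate-↑ ν h) (≡.cong (List.tabulate (h ∘ (_↑ˡ (n ℕ.* ν))) ++_) (tabulate-combine n (h ∘ (ν ↑ʳ_))))

concatTabulate-cong : {K K′ : Fin n → List A} → (∀ i → K i ≡ K′ i) → concatTabulate K ≡ concatTabulate K′
concatTabulate-cong K≡K′ = ≡.cong List.concat (List.tabulate-cong K≡K′)

filterᵇ-concatTabulate : (P : A → Bool) (K : Fin n → List A) →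
                         filterᵇ P (concatTabulate K) ≡ concatTabulate (filterᵇ P ∘ K)
filterᵇ-concatTabulate {n = zero}  P K = ≡.refl
filterᵇ-concatTabulate {n = suc n} P K = ≡.trans (List.filter-++ (T? ∘ P) (K zero) _)
  (≡.cong (filterᵇ P (K zero) ++_) (filterᵇ-concatTabulate P (K ∘ suc)))

elementList : Subset m → List (Fin m)
elementList p = toList (elements p)

length-elementList : (p : Subset m) → length (elementList p) ≡ ∣ p ∣
length-elementList p = ≡.trans (≡.cong length (toList-tabulate (elements p))) (List.length-tabulate _)

-- The map `g` is arbitrary because the induction replaces it by `g ∘ suc`, and because a fibre of 𝔷
-- has to be compared with 𝔷 itself along `combine s`.
map-elementList : (p : Subset m) (g : Fin m → A) (P : A → Bool) → (∀ i → P (g i) ≡ lookup p i) →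
                  map g (elementList p) ≡ filterᵇ P (List.tabulate g)
map-elementList []            g P eq = ≡.refl
map-elementList (inside ∷ p)  g P eq with P (g zero) | eq zero
... | true | ≡.refl = ≡.cong (g zero ∷_) (≡.trans (≡.trans (≡.cong (map g) (Vec.toList-map suc (elements p)))
  (≡.sym (List.map-∘ (elementList p)))) (map-elementList p (g ∘ suc) P (eq ∘ suc)))
map-elementList (outside ∷ p) g P eq with P (g zero) | eq zero
... | false | ≡.refl = ≡.trans (≡.trans (≡.cong (map g) (Vec.toList-map suc (elements p)))
  (≡.sym (List.map-∘ (elementList p)))) (map-elementList p (g ∘ suc) P (eq ∘ suc))

lookup-elements : (p : Subset m) (i : Fin ∣ p ∣) → lookup p (lookup (elements p) i) ≡ inside
lookup-elements (inside ∷ p)  zero    = ≡.refl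
lookup-elements (inside ∷ p)  (suc i) rewrite Vec.lookup-map i Fin.suc (elements p) = lookup-elements p i
lookup-elements (outside ∷ p) i       rewrite Vec.lookup-map i Fin.suc (elements p) = lookup-elements p i

-- Needed to order the points that belong to one letter.
elements-mono : (p : Subset m) {i j : Fin ∣ p ∣} → i Fin.< j → lookup (elements p) i Fin.< lookup (elements p) j
elements-mono (inside ∷ p)  {zero}  {suc j} lt rewrite Vec.lookup-map j Fin.suc (elements p) = ℕ.z<s
elements-mono (inside ∷ p)  {suc i} {suc j} (ℕ.s≤s lt)
  rewrite Vec.lookup-map i Fin.suc (elements p) | Vec.lookup-map j Fin.suc (elements p) = ℕ.s≤s (elements-mono p lt)
elements-mono (outside ∷ p) {i}     {j}     lt
  rewrite Vec.lookup-map i Fin.suc (elements p) | Vec.lookup-map j Fin.suc (elements p) = ℕ.s≤s (elements-mono p lt)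

-- This bound keeps the truncated subtraction in `Λ` exact.
toℕ≤elements : (p : Subset m) (i : Fin ∣ p ∣) → i Fin.≤ lookup (elements p) i
toℕ≤elements (inside ∷ p)  zero    = ℕ.z≤n
toℕ≤elements (inside ∷ p)  (suc i) rewrite Vec.lookup-map i Fin.suc (elements p) = ℕ.s≤s (toℕ≤elements p i)
toℕ≤elements (outside ∷ p) i       rewrite Vec.lookup-map i Fin.suc (elements p) =
  ℕ.≤-trans (toℕ≤elements p i) (ℕ.n≤1+n _)

lookup-∷ʳ-fromℕ : (xs : Vec A n) (x : A) → lookup (xs Vec.∷ʳ x) (fromℕ n) ≡ x
lookup-∷ʳ-fromℕ []       x = ≡.refl
lookup-∷ʳ-fromℕ (_ ∷ xs) x = lookup-∷ʳ-fromℕ xs x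

lookup-∷ʳ-inject₁ : (xs : Vec A n) (x : A) (i : Fin n) → lookup (xs Vec.∷ʳ x) (inject₁ i) ≡ lookup xs i
lookup-∷ʳ-inject₁ (_ ∷ xs) x zero    = ≡.refl
lookup-∷ʳ-inject₁ (_ ∷ xs) x (suc i) = lookup-∷ʳ-inject₁ xs x i

lookup-reverse-opposite : (xs : Vec A n) (i : Fin n) → lookup (Vec.reverse xs) (opposite i) ≡ lookup xs i
lookup-reverse-opposite (x ∷ xs) zero    rewrite Vec.reverse-∷ x xs = lookup-∷ʳ-fromℕ (Vec.reverse xs) x
lookup-reverse-opposite (x ∷ xs) (suc i) rewrite Vec.reverse-∷ x xs =
  ≡.trans (lookup-∷ʳ-inject₁ (Vec.reverse xs) x (opposite i)) (lookup-reverse-opposite xs i)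

module _ (v : Vec (Fin n) N) where

  open Word (lookup v)

  elementList-positions : ∀ s → elementList (positions v s) ≡ filterᵇ (isLetter s) (List.allFin N)
  elementList-positions s = ≡.trans (≡.sym (List.map-id _))
    (map-elementList (positions v s) id (isLetter s) λ j → ≡.sym (Vec.lookup∘tabulate _ j))

  lookup-positions : ∀ s i → lookup v (lookup (elements (positions v s)) i) ≡ s
  lookup-positions s i = isLetter-true s _
    (≡.trans (≡.sym (Vec.lookup∘tabulate (isLetter s) _)) (lookup-elements (positions v s) i))

module _ (v : Vec (Fin n) N) (ν : ℕ) where

  open Minors v ν

  -- Lexicographic order lists 𝔷 letter by letter, so the rows of X_𝔷 are already grouped into
  -- blocks and only its columns need sorting.
  elementList-taggedRows : (𝔷 : Subset (n ℕ.* ν)) →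
    elementList 𝔷 ≡ map (uncurry combine) (taggedRows (λ s → elementList (fibre 𝔷 s)))
  elementList-taggedRows 𝔷 = begin
    elementList 𝔷
      ≡⟨ List.map-id (elementList 𝔷) ⟨
    map id (elementList 𝔷)
      ≡⟨ map-elementList 𝔷 id (lookup 𝔷) (λ _ → ≡.refl) ⟩
    filterᵇ (lookup 𝔷) (List.tabulate id)
      ≡⟨ ≡.cong (filterᵇ (lookup 𝔷)) (tabulate-combine n id) ⟩
    filterᵇ (lookup 𝔷) (concatTabulate (λ s → List.tabulate (combine {n} s)))
      ≡⟨ filterᵇ-concatTabulate (lookup 𝔷) (λ s → List.tabulate (combine {n} s)) ⟩
    concatTabulate (λ s → filterᵇ (lookup 𝔷) (List.tabulate (combine {n} s)))
      ≡⟨ concatTabulate-cong (λ s → ≡.sym (map-elementList (fibre 𝔷 s) (combine s) (lookup 𝔷)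
           (λ k → ≡.sym (Vec.lookup∘tabulate _ k)))) ⟩
    concatTabulate (λ s → map (combine s) (elementList (fibre 𝔷 s)))
      ≡⟨ concatTabulate-cong (λ s → List.map-∘ (elementList (fibre 𝔷 s))) ⟩
    concatTabulate (λ s → map (uncurry combine) (map (s ,_) (elementList (fibre 𝔷 s))))
      ≡⟨ ≡.cong List.concat (List.map-tabulate (λ s → map (s ,_) (elementList (fibre 𝔷 s))) (map (uncurry combine))) ⟨
    List.concat (map (map (uncurry combine)) (List.tabulate (λ s → map (s ,_) (elementList (fibre 𝔷 s)))))
      ≡⟨ List.concat-map (List.tabulate (λ s → map (s ,_) (elementList (fibre 𝔷 s)))) ⟩
    map (uncurry combine) (taggedRows (λ s → elementList (fibre 𝔷 s))) ∎
    where open ≡.≡-Reasoning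

  -- The staircase subtracted in `Λ` is the one added back in `exponents`, and `opposite` undoes the
  -- decreasing order. Hence the Schur numerator has the powers occurring in the block of `s`, in
  -- the same order.
  exponents-Λ : ∀ 𝔷 (𝔷∈ℨ : 𝔷 ∈ℨ) s →
    List.tabulate (Schur.exponents N (Λ 𝔷 𝔷∈ℨ s)) ≡ map toℕ (elementList (fibre 𝔷 s))
  exponents-Λ 𝔷 𝔷∈ℨ s = begin
    List.tabulate (Schur.exponents N (Λ 𝔷 𝔷∈ℨ s))  ≡⟨ List.tabulate-cong exponent ⟩
    List.tabulate (lookup w)                       ≡⟨ toList-tabulate w ⟨
    toList w                                       ≡⟨ Vec.toList-cast (𝔷∈ℨ s) _ ⟩
    toList (Vec.map toℕ (elements (fibre 𝔷 s)))    ≡⟨ Vec.toList-map toℕ (elements (fibre 𝔷 s)) ⟩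
    map toℕ (elementList (fibre 𝔷 s))              ∎
    where
    open ≡.≡-Reasoning
    d = occurrences v s
    w : Vec ℕ d
    w = Vec.cast (𝔷∈ℨ s) (Vec.map toℕ (elements (fibre 𝔷 s)))
    lookup-w : ∀ i → lookup w i ≡ toℕ (lookup (elements (fibre 𝔷 s)) (Fin.cast (≡.sym (𝔷∈ℨ s)) i))
    lookup-w i = ≡.trans (Vec.lookup-cast₁ (𝔷∈ℨ s) (Vec.map toℕ (elements (fibre 𝔷 s))) i)
      (Vec.lookup-map _ toℕ (elements (fibre 𝔷 s)))
    i≤w : ∀ i → toℕ i ℕ.≤ lookup w i
    i≤w i = ≡.subst₂ ℕ._≤_ (Fin.toℕ-cast (≡.sym (𝔷∈ℨ s)) i) (≡.sym (lookup-w i))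
      (toℕ≤elements (fibre 𝔷 s) (Fin.cast (≡.sym (𝔷∈ℨ s)) i))
    -- `opposite i` is d - 1 - i in 0-based counting, so the amount subtracted there is i.
    index : ∀ (i : Fin d) → d ℕ.∸ suc (toℕ (opposite i)) ≡ toℕ i
    index i = ≡.trans (≡.sym (Fin.opposite-prop (opposite i))) (≡.cong toℕ (Fin.opposite-involutive i))
    exponent : ∀ i → Schur.exponents N (Λ 𝔷 𝔷∈ℨ s) i ≡ lookup w i
    exponent i = begin
      toℕ i ℕ.+ lookup (Λ 𝔷 𝔷∈ℨ s) (opposite i)
        ≡⟨ ≡.cong (toℕ i ℕ.+_) (Vec.lookup∘tabulate _ (opposite i)) ⟩
      toℕ i ℕ.+ (lookup (Vec.reverse w) (opposite i) ℕ.∸ (d ℕ.∸ suc (toℕ (opposite i))))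
        ≡⟨ ≡.cong₂ (λ p q → toℕ i ℕ.+ (p ℕ.∸ q)) (lookup-reverse-opposite w i) (index i) ⟩
      toℕ i ℕ.+ (lookup w i ℕ.∸ toℕ i)
        ≡⟨ ℕ.m+[n∸m]≡n (i≤w i) ⟩
      lookup w i ∎

-- Agreement of the recursive inversion count with the count over pairs

length-filterᵇ-++ : ∀ (P : A → Bool) xs ys →
                    length (filterᵇ P (xs ++ ys)) ≡ length (filterᵇ P xs) ℕ.+ length (filterᵇ P ys)
length-filterᵇ-++ P xs ys = ≡.trans (≡.cong length (List.filter-++ (T? ∘ P) xs ys)) (List.length-++ (filterᵇ P xs))

module _ (v : Fin N → Fin n) where

  open Word v

  isInversion : Fin N × Fin N → Bool
  isInversion (a , b) = (toℕ a ℕ.<ᵇ toℕ b) ∧ isBelow a b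

  count-row : ∀ y ys → All (y Fin.<_) ys →
              length (filterᵇ isInversion (map (y ,_) ys)) ≡ length (filterᵇ (isBelow y) ys)
  count-row y []       []         = ≡.refl
  count-row y (z ∷ zs) (y<z ∷ ps) with toℕ y ℕ.<ᵇ toℕ z | ℕ.<⇒<ᵇ y<z
  ... | true | _ with isBelow y z
  ...   | true  = ≡.cong suc (count-row y zs ps)
  ...   | false = count-row y zs ps

  -- A pair `(x , y)` with `y` before `x` fails the first condition of an inversion.
  count-dropColumn : ∀ y ys xs → All (y Fin.<_) xs →
                     length (filterᵇ isInversion (List.cartesianProduct xs (y ∷ ys))) ≡
                     length (filterᵇ isInversion (List.cartesianProduct xs ys))
  count-dropColumn y ys []       []         = ≡.refl
  count-dropColumn y ys (x ∷ xs) (y<x ∷ ps) with toℕ x ℕ.<ᵇ toℕ y in eq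
  ... | true  = ⊥-elim (ℕ.<-asym y<x (ℕ.<ᵇ⇒< _ _ (≡.subst T (≡.sym eq) _)))
  ... | false = begin
    length (filterᵇ isInversion (map (x ,_) ys ++ List.cartesianProduct xs (y ∷ ys)))
      ≡⟨ length-filterᵇ-++ isInversion (map (x ,_) ys) _ ⟩
    length (filterᵇ isInversion (map (x ,_) ys))
      ℕ.+ length (filterᵇ isInversion (List.cartesianProduct xs (y ∷ ys)))
      ≡⟨ ≡.cong (length (filterᵇ isInversion (map (x ,_) ys)) ℕ.+_) (count-dropColumn y ys xs ps) ⟩
    length (filterᵇ isInversion (map (x ,_) ys))
      ℕ.+ length (filterᵇ isInversion (List.cartesianProduct xs ys))
      ≡⟨ length-filterᵇ-++ isInversion (map (x ,_) ys) _ ⟨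
    length (filterᵇ isInversion (map (x ,_) ys ++ List.cartesianProduct xs ys)) ∎
    where
    open ≡.≡-Reasoning

  -- In an increasing list, standing behind an entry means having a larger index. So of the pairs
  -- that involve the head only those with the head on the left can count.
  inv≡count : ∀ xs → AllPairs Fin._<_ xs → inv xs ≡ length (filterᵇ isInversion (List.cartesianProduct xs xs))
  inv≡count []       []       = ≡.refl
  inv≡count (x ∷ xs) (p ∷ ps) = ≡.sym (begin
    length (filterᵇ isInversion (map (x ,_) (x ∷ xs) ++ List.cartesianProduct xs (x ∷ xs)))
      ≡⟨ length-filterᵇ-++ isInversion (map (x ,_) (x ∷ xs)) _ ⟩
    length (filterᵇ isInversion (map (x ,_) (x ∷ xs)))
      ℕ.+ length (filterᵇ isInversion (List.cartesianProduct xs (x ∷ xs)))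
      ≡⟨ ≡.cong₂ ℕ._+_ (≡.trans diagonal (count-row x xs p))
           (≡.trans (count-dropColumn x xs xs p) (≡.sym (inv≡count xs ps))) ⟩
    inv (x ∷ xs) ∎)
    where
    open ≡.≡-Reasoning
    diagonal : length (filterᵇ isInversion (map (x ,_) (x ∷ xs))) ≡ length (filterᵇ isInversion (map (x ,_) xs))
    diagonal with toℕ x ℕ.<ᵇ toℕ x in eq
    ... | true  = ⊥-elim (ℕ.<-irrefl ≡.refl (ℕ.<ᵇ⇒< (toℕ x) _ (≡.subst T (≡.sym eq) _)))
    ... | false = ≡.refl

length-filter-does : {P : A → Set} (P? : ∀ x → Dec (P x)) (Q : A → Bool) →
                     (∀ x → does (P? x) ≡ Q x) → ∀ xs →
                     length (List.filter P? xs) ≡ length (filterᵇ Q xs)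
length-filter-does P? Q P≡Q []       = ≡.refl
length-filter-does P? Q P≡Q (x ∷ xs) with does (P? x) | Q x | P≡Q x
... | true  | true  | _ = ≡.cong suc (length-filter-does P? Q P≡Q xs)
... | false | false | _ = length-filter-does P? Q P≡Q xs

inversions≡inv : (v : Vec (Fin n) N) → inversions v ≡ Word.inv (lookup v) (List.allFin N)
inversions≡inv {N = N} v = ≡.trans
  (length-filter-does _ (isInversion (lookup v)) (λ _ → ≡.refl)
    (List.cartesianProduct (List.allFin N) (List.allFin N)))
  (≡.sym (inv≡count (lookup v) (List.allFin N) (AllPairs.tabulate⁺-< id)))

-- Determinants over lists of row and column labels

module ListDeterminant (R : CommutativeRing c ℓ) where

  open CommutativeRing R hiding (zero)
  open RingProperties ring
  open CommutativeSemigroupProperties *-commutativeSemigroup using (x∙yz≈y∙xz)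
  open CommutativeMonoidSum *-commutativeMonoid using () renaming (sum to ∏; sum-cong-≋ to ∏-cong)
  open SetoidReasoning setoid
  open SemiringSolver commutativeSemiring using (solve; _:+_; _:*_; _:=_)

  interchange : ∀ w x y z → (w + x) + (y + z) ≈ (w + y) + (x + z)
  interchange = solve 4 (λ w x y z → (w :+ x) :+ (y :+ z) := (w :+ y) :+ (x :+ z)) refl

  -+-distrib : ∀ x y → - (x + y) ≈ - x - y
  -+-distrib x y = sym (-‿+-comm x y)

  interchange-- : ∀ w x y z → (w + x) - (y + z) ≈ (w - y) + (x - z)
  interchange-- w x y z = trans (+-congˡ (-+-distrib y z)) (interchange w x (- y) (- z))

  0-0≈0 : 0# - 0# ≈ 0#
  0-0≈0 = -‿inverseʳ 0#

  -- ∑ᵢ (-1)ⁱ f(xᵢ , xs without xᵢ), with i counted from 0.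
  ∑± : List A → (A → List A → Carrier) → Carrier
  ∑± []       f = 0#
  ∑± (x ∷ xs) f = f x xs - ∑± xs (λ y ys → f y (x ∷ ys))

  ∑±-cong : (xs : List A) {f g : A → List A → Carrier} →
            (∀ y ys → f y ys ≈ g y ys) → ∑± xs f ≈ ∑± xs g
  ∑±-cong []       f≈g = refl
  ∑±-cong (x ∷ xs) f≈g = +-cong (f≈g x xs) (-‿cong (∑±-cong xs λ y ys → f≈g y (x ∷ ys)))

  ∑±-zero : (xs : List A) {f : A → List A → Carrier} → (∀ y ys → f y ys ≈ 0#) → ∑± xs f ≈ 0#
  ∑±-zero []       f≈0 = refl
  ∑±-zero (x ∷ xs) f≈0 =
    trans (+-cong (f≈0 x xs) (-‿cong (∑±-zero xs λ y ys → f≈0 y (x ∷ ys)))) 0-0≈0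

  ∑±-+ : (xs : List A) (f g : A → List A → Carrier) →
         ∑± xs (λ y ys → f y ys + g y ys) ≈ ∑± xs f + ∑± xs g
  ∑±-+ []       f g = sym (+-identityʳ 0#)
  ∑±-+ (x ∷ xs) f g = trans (+-congˡ (-‿cong (∑±-+ xs _ _))) (interchange-- _ _ _ _)

  ∑±-neg : (xs : List A) (f : A → List A → Carrier) → ∑± xs (λ y ys → - f y ys) ≈ - ∑± xs f
  ∑±-neg []       f = sym -0#≈0#
  ∑±-neg (x ∷ xs) f = trans (+-congˡ (-‿cong (∑±-neg xs _))) (sym (-+-distrib _ _))

  ∑±-- : (xs : List A) (f g : A → List A → Carrier) →
         ∑± xs (λ y ys → f y ys - g y ys) ≈ ∑± xs f - ∑± xs g
  ∑±-- xs f g = trans (∑±-+ xs f _) (+-congˡ (∑±-neg xs g))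

  *-distribˡ-∑± : (xs : List A) (t : Carrier) (f : A → List A → Carrier) →
                  t * ∑± xs f ≈ ∑± xs (λ y ys → t * f y ys)
  *-distribˡ-∑± []       t f = zeroʳ t
  *-distribˡ-∑± (x ∷ xs) t f =
    trans (x[y-z]≈xy-xz t _ _) (+-congˡ (-‿cong (*-distribˡ-∑± xs t _)))

  *-distribʳ-∑± : (xs : List A) (t : Carrier) (f : A → List A → Carrier) →
                  ∑± xs f * t ≈ ∑± xs (λ y ys → f y ys * t)
  *-distribʳ-∑± xs t f = trans (*-comm _ t)
    (trans (*-distribˡ-∑± xs t f) (∑±-cong xs λ y ys → *-comm t (f y ys)))

  ∑±-comm : (xs : List A) (ys : List B) (f : A → List A → B → List B → Carrier) →
            ∑± xs (λ x xs′ → ∑± ys (λ y ys′ → f x xs′ y ys′)) ≈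
            ∑± ys (λ y ys′ → ∑± xs (λ x xs′ → f x xs′ y ys′))
  ∑±-comm []       ys f = sym (∑±-zero ys λ _ _ → refl)
  ∑±-comm (x ∷ xs) ys f = trans (+-congˡ (-‿cong (∑±-comm xs ys _))) (sym (∑±-- ys _ _))

  ∑±-map : (h : A → B) (xs : List A) (f : B → List B → Carrier) →
           ∑± (map h xs) f ≈ ∑± xs (λ y ys → f (h y) (map h ys))
  ∑±-map h []       f = refl
  ∑±-map h (x ∷ xs) f = +-congˡ (-‿cong (∑±-map h xs _))

  -- Two entries can be removed in either order, with opposite signs: once the earlier one is gone,
  -- the later one has moved up by one place.
  ∑±∑±-symmetric : (xs : List A) (T : A → A → List A → Carrier) → (∀ x y zs → T x y zs ≈ T y x zs) →
                   ∑± xs (λ x ys → ∑± ys (T x)) ≈ 0#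
  ∑±∑±-symmetric []       T T-sym = refl
  ∑±∑±-symmetric (x ∷ xs) T T-sym = begin
    ∑± xs (T x) - ∑± xs (λ y ys → T y x ys - ∑± ys (λ z zs → T y z (x ∷ zs)))
      ≈⟨ +-congˡ (-‿cong (∑±-- xs _ _)) ⟩
    ∑± xs (T x) - (∑± xs (λ y → T y x) - ∑± xs (λ y ys → ∑± ys (λ z zs → T y z (x ∷ zs))))
      ≈⟨ +-cong (∑±-cong xs (T-sym x))
           (-‿cong (+-congˡ (-‿cong (∑±∑±-symmetric xs _ λ y z zs → T-sym y z (x ∷ zs))))) ⟩
    ∑± xs (λ y → T y x) - (∑± xs (λ y → T y x) - 0#)
      ≈⟨ +-congˡ (-‿cong (trans (+-congˡ -0#≈0#) (+-identityʳ _))) ⟩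
    ∑± xs (λ y → T y x) - ∑± xs (λ y → T y x)
      ≈⟨ -‿inverseʳ _ ⟩
    0# ∎

  -- The sum of `T` and its transpose is symmetric, so the preceding cancellation applies to it.
  ∑±∑±-swap : (xs : List A) (T : A → A → List A → Carrier) →
              ∑± xs (λ x ys → ∑± ys (T x)) ≈ - ∑± xs (λ x ys → ∑± ys (λ y → T y x))
  ∑±∑±-swap xs T = +-inverseˡ-unique _ _ (begin
    ∑± xs (λ x ys → ∑± ys (T x)) + ∑± xs (λ x ys → ∑± ys (λ y → T y x))
      ≈⟨ ∑±-+ xs _ _ ⟨
    ∑± xs (λ x ys → ∑± ys (T x) + ∑± ys (λ y → T y x))
      ≈⟨ ∑±-cong xs (λ x ys → ∑±-+ ys _ _) ⟨
    ∑± xs (λ x ys → ∑± ys (λ y zs → T x y zs + T y x zs))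
      ≈⟨ ∑±∑±-symmetric xs _ (λ x y zs → +-comm _ _) ⟩
    0# ∎)

  ifEmpty : List A → Carrier
  ifEmpty []      = 1#
  ifEmpty (_ ∷ _) = 0#

  -- The determinant of (e r s) with rows rs and columns cs; it is 0 when
  -- the two lists have different lengths.
  detᴸ : (A → B → Carrier) → List A → List B → Carrier
  detᴸ e rs []       = ifEmpty rs
  detᴸ e rs (s ∷ cs) = ∑± rs (λ r rs′ → e r s * detᴸ e rs′ cs)

  detᴸ-cong : {e e′ : A → B → Carrier} → (∀ r s → e r s ≈ e′ r s) →
             ∀ rs cs → detᴸ e rs cs ≈ detᴸ e′ rs cs
  detᴸ-cong e≈e′ rs []       = refl
  detᴸ-cong e≈e′ rs (s ∷ cs) = ∑±-cong rs λ r rs′ → *-cong (e≈e′ r s) (detᴸ-cong e≈e′ rs′ cs)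

  detᴸ-mapˡ : (h : A′ → A) (e : A → B → Carrier) (rs : List A′) (cs : List B) →
             detᴸ e (map h rs) cs ≈ detᴸ (λ r → e (h r)) rs cs
  detᴸ-mapˡ h e []       []       = refl
  detᴸ-mapˡ h e (r ∷ rs) []       = refl
  detᴸ-mapˡ h e rs       (s ∷ cs) =
    trans (∑±-map h rs _) (∑±-cong rs λ r rs′ → *-congˡ (detᴸ-mapˡ h e rs′ cs))

  detᴸ-length≢ : (e : A → B → Carrier) (rs : List A) (cs : List B) → length rs ≢ length cs → detᴸ e rs cs ≈ 0#
  detᴸ-length≢ e []       []       ≢ = ⊥-elim (≢ ≡.refl)
  detᴸ-length≢ e (r ∷ rs) []       ≢ = refl
  detᴸ-length≢ e rs       (s ∷ cs) ≢ = ∑±-zero′ rs λ r rs′ eq →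
    trans (*-congˡ (detᴸ-length≢ e rs′ cs λ eq′ → ≢ (≡.trans (≡.sym eq) (≡.cong suc eq′)))) (zeroʳ _)
    where
    -- Unlike `∑±-zero`, this remembers that one entry has been removed, which is what lets the
    -- unequal lengths pass to the minors.
    ∑±-zero′ : (xs : List A) {f : A → List A → Carrier} →
      (∀ y ys → suc (length ys) ≡ length xs → f y ys ≈ 0#) → ∑± xs f ≈ 0#
    ∑±-zero′ []       f≈0 = refl
    ∑±-zero′ (x ∷ xs) f≈0 =
      trans (+-cong (f≈0 x xs ≡.refl) (-‿cong (∑±-zero′ xs λ y ys eq → f≈0 y (x ∷ ys) (≡.cong suc eq)))) 0-0≈0

  -- Expansions along the first column and along the first row share the corner term. In the other
  -- terms one row and one column are removed from separate lists, so the two sums may be exchanged.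
  detᴸ-expandRow : (e : A → B → Carrier) (r : A) (rs : List A) (cs : List B) →
                  detᴸ e (r ∷ rs) cs ≈ ∑± cs (λ s cs′ → e r s * detᴸ e rs cs′)
  detᴸ-expandRow e r rs []       = refl
  detᴸ-expandRow e r rs (s ∷ cs) = +-congˡ (-‿cong (begin
    ∑± rs (λ r′ rs′ → e r′ s * detᴸ e (r ∷ rs′) cs)
      ≈⟨ ∑±-cong rs (λ r′ rs′ → trans (*-congˡ (detᴸ-expandRow e r rs′ cs)) (*-distribˡ-∑± cs _ _)) ⟩
    ∑± rs (λ r′ rs′ → ∑± cs (λ s′ cs′ → e r′ s * (e r s′ * detᴸ e rs′ cs′)))
      ≈⟨ ∑±-comm rs cs _ ⟩
    ∑± cs (λ s′ cs′ → ∑± rs (λ r′ rs′ → e r′ s * (e r s′ * detᴸ e rs′ cs′)))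
      ≈⟨ ∑±-cong cs (λ s′ cs′ → trans (*-distribˡ-∑± rs _ _) (∑±-cong rs λ r′ rs′ → x∙yz≈y∙xz _ _ _)) ⟨
    ∑± cs (λ s′ cs′ → e r s′ * ∑± rs (λ r′ rs′ → e r′ s * detᴸ e rs′ cs′)) ∎))

  -- Matrix determinant lemma in adjugate form: in the multilinear expansion, terms that take the
  -- rank-one part in two columns cancel in pairs.
  detᴸ-rankOne : (u : A → Carrier) (w : B → Carrier) (e : A → B → Carrier) (rs : List A) (cs : List B) →
                detᴸ (λ r s → u r * w s + e r s) rs cs ≈
                detᴸ e rs cs + ∑± rs (λ r rs′ → u r * ∑± cs (λ s cs′ → w s * detᴸ e rs′ cs′))
  detᴸ-rankOne u w e rs [] =
    sym (trans (+-congˡ (∑±-zero rs λ r _ → zeroʳ (u r))) (+-identityʳ _))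
  detᴸ-rankOne u w e rs (s ∷ cs) = begin
    ∑± rs (λ r rs′ → (u r * w s + e r s) * detᴸ (λ r s → u r * w s + e r s) rs′ cs)
      ≈⟨ ∑±-cong rs (λ r rs′ → *-congˡ (detᴸ-rankOne u w e rs′ cs)) ⟩
    ∑± rs (λ r rs′ → (u r * w s + e r s) * (d rs′ + X rs′))
      ≈⟨ ∑±-cong rs (λ r rs′ → expand (u r * w s) (e r s) (d rs′) (X rs′)) ⟩
    ∑± rs (λ r rs′ → (e r s * d rs′ + u r * w s * d rs′) + (u r * w s * X rs′ + e r s * X rs′))
      ≈⟨ trans (∑±-+ rs _ _) (+-cong (∑±-+ rs _ _) (∑±-+ rs _ _)) ⟩
    (detᴸ e rs (s ∷ cs) + ∑± rs (λ r rs′ → u r * w s * d rs′))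
      + (∑± rs (λ r rs′ → u r * w s * X rs′) + ∑± rs (λ r rs′ → e r s * X rs′))
      ≈⟨ +-congˡ (trans (+-cong vanish swap) (+-identityˡ _)) ⟩
    (detᴸ e rs (s ∷ cs) + ∑± rs (λ r rs′ → u r * w s * d rs′))
      - ∑± rs (λ r rs′ → u r * ∑± cs (λ s′ cs′ → w s′ * detᴸ e rs′ (s ∷ cs′)))
      ≈⟨ +-assoc _ _ _ ⟩
    detᴸ e rs (s ∷ cs) + (∑± rs (λ r rs′ → u r * w s * d rs′)
      - ∑± rs (λ r rs′ → u r * ∑± cs (λ s′ cs′ → w s′ * detᴸ e rs′ (s ∷ cs′))))
      ≈⟨ +-congˡ (trans
           (∑±-cong rs λ r rs′ → trans (x[y-z]≈xy-xz _ _ _) (+-congʳ (sym (*-assoc _ _ _))))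
           (∑±-- rs _ _)) ⟨
    detᴸ e rs (s ∷ cs) + ∑± rs (λ r rs′ → u r * ∑± (s ∷ cs) (λ s′ cs′ → w s′ * detᴸ e rs′ cs′)) ∎
    where
    d = λ rs → detᴸ e rs cs
    H = λ rs → ∑± cs (λ s cs′ → w s * detᴸ e rs cs′)
    X = λ rs → ∑± rs (λ r rs′ → u r * H rs′)
    expand : ∀ p q d x → (p + q) * (d + x) ≈ (q * d + p * d) + (p * x + q * x)
    expand = solve 4 (λ p q d x → (p :+ q) :* (d :+ x) := (q :* d :+ p :* d) :+ (p :* x :+ q :* x)) refl
    -- The rank-one part is used for two removed rows, and the summand is symmetric in them.
    vanish : ∑± rs (λ r rs′ → u r * w s * X rs′) ≈ 0#
    vanish = trans (∑±-cong rs λ r rs′ → *-distribˡ-∑± rs′ _ _)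
      (∑±∑±-symmetric rs _ λ x y zs →
        solve 4 (λ x y w h → x :* w :* (y :* h) := y :* w :* (x :* h)) refl (u x) (u y) (w s) (H zs))
    expandH : ∀ rs → ∑± cs (λ s′ cs′ → w s′ * detᴸ e rs (s ∷ cs′)) ≈ ∑± rs (λ r rs′ → e r s * H rs′)
    expandH rs = begin
      ∑± cs (λ s′ cs′ → w s′ * ∑± rs (λ r rs′ → e r s * detᴸ e rs′ cs′))
        ≈⟨ ∑±-cong cs (λ s′ cs′ → trans (*-distribˡ-∑± rs _ _) (∑±-cong rs λ r rs′ → x∙yz≈y∙xz _ _ _)) ⟩
      ∑± cs (λ s′ cs′ → ∑± rs (λ r rs′ → e r s * (w s′ * detᴸ e rs′ cs′)))
        ≈⟨ ∑±-comm cs rs _ ⟩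
      ∑± rs (λ r rs′ → ∑± cs (λ s′ cs′ → e r s * (w s′ * detᴸ e rs′ cs′)))
        ≈⟨ ∑±-cong rs (λ r rs′ → *-distribˡ-∑± cs _ _) ⟨
      ∑± rs (λ r rs′ → e r s * H rs′) ∎
    -- Exchanging the two removed rows yields the minus sign with which the columns behind `s` enter
    -- `∑± (s ∷ cs)`.
    swap : ∑± rs (λ r rs′ → e r s * X rs′) ≈
           - ∑± rs (λ r rs′ → u r * ∑± cs (λ s′ cs′ → w s′ * detᴸ e rs′ (s ∷ cs′)))
    swap = begin
      ∑± rs (λ r rs′ → e r s * X rs′)
        ≈⟨ ∑±-cong rs (λ r rs′ → *-distribˡ-∑± rs′ _ _) ⟩
      ∑± rs (λ r rs′ → ∑± rs′ (λ r′ rs″ → e r s * (u r′ * H rs″)))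
        ≈⟨ ∑±∑±-swap rs _ ⟩
      - ∑± rs (λ r rs′ → ∑± rs′ (λ r′ rs″ → e r′ s * (u r * H rs″)))
        ≈⟨ -‿cong (∑±-cong rs λ r rs′ →
             trans (∑±-cong rs′ λ r′ rs″ → x∙yz≈y∙xz _ _ _) (sym (*-distribˡ-∑± rs′ _ _))) ⟩
      - ∑± rs (λ r rs′ → u r * ∑± rs′ (λ r′ rs″ → e r′ s * H rs″))
        ≈⟨ -‿cong (∑±-cong rs λ r rs′ → *-congˡ (expandH rs′)) ⟨
      - ∑± rs (λ r rs′ → u r * ∑± cs (λ s′ cs′ → w s′ * detᴸ e rs′ (s ∷ cs′))) ∎

  -- The Cauchy-Binet formula

  ∑∈ : List A → (A → Carrier) → Carrier
  ∑∈ []       f = 0#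
  ∑∈ (x ∷ xs) f = f x + ∑∈ xs f

  ∑sublists : List A → (List A → Carrier) → Carrier
  ∑sublists []       f = f []
  ∑sublists (x ∷ xs) f = ∑sublists xs f + ∑sublists xs (λ ys → f (x ∷ ys))

  ∑sublists-cong : (xs : List A) {f g : List A → Carrier} → (∀ ys → f ys ≈ g ys) → ∑sublists xs f ≈ ∑sublists xs g
  ∑sublists-cong []       f≈g = f≈g []
  ∑sublists-cong (x ∷ xs) f≈g = +-cong (∑sublists-cong xs f≈g) (∑sublists-cong xs λ ys → f≈g (x ∷ ys))

  *-distribˡ-∑sublists : (xs : List A) (t : Carrier) (f : List A → Carrier) →
                         t * ∑sublists xs f ≈ ∑sublists xs (λ ys → t * f ys)
  *-distribˡ-∑sublists []       t f = refl
  *-distribˡ-∑sublists (x ∷ xs) t f =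
    trans (distribˡ t _ _) (+-cong (*-distribˡ-∑sublists xs t _) (*-distribˡ-∑sublists xs t _))

  ∑±-∑sublists : (qs : List B) (xs : List A) (f : A → List A → List B → Carrier) →
                 ∑± xs (λ y ys → ∑sublists qs (f y ys)) ≈ ∑sublists qs (λ p → ∑± xs (λ y ys → f y ys p))
  ∑±-∑sublists []       xs f = refl
  ∑±-∑sublists (q ∷ qs) xs f = trans (∑±-+ xs _ _) (+-cong (∑±-∑sublists qs xs _) (∑±-∑sublists qs xs _))

  -- A new middle label `q` is a rank-one update of the product. The old determinant accounts for
  -- the sublists without `q`; the correction accounts for those with `q`, as it pairs the expansion
  -- of `p` along column `q` with that of `x` along row `q`. Sublists of a wrong length contribute
  -- 0.
  cauchyBinet : (p : A → C → Carrier) (x : C → B → Carrier) (qs : List C) (rs : List A) (cs : List B) →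
                detᴸ (λ r s → ∑∈ qs (λ q → p r q * x q s)) rs cs ≈
                ∑sublists qs (λ ys → detᴸ p rs ys * detᴸ x ys cs)
  cauchyBinet p x [] rs []       = sym (*-identityʳ _)
  cauchyBinet p x [] rs (s ∷ cs) = trans (∑±-zero rs λ r _ → zeroˡ _) (sym (zeroʳ _))
  cauchyBinet p x (q ∷ qs) rs cs = trans
    (detᴸ-rankOne (λ r → p r q) (x q) (λ r s → ∑∈ qs (λ q → p r q * x q s)) rs cs)
    (+-cong (cauchyBinet p x qs rs cs) (begin
      ∑± rs (λ r rs′ → p r q * ∑± cs (λ s cs′ → x q s * detᴸ (λ r s → ∑∈ qs (λ q → p r q * x q s)) rs′ cs′))
        ≈⟨ ∑±-cong rs (λ r rs′ → *-congˡ (inner rs′)) ⟩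
      ∑± rs (λ r rs′ → p r q * ∑sublists qs (λ ys → detᴸ p rs′ ys * detᴸ x (q ∷ ys) cs))
        ≈⟨ ∑±-cong rs (λ r rs′ → trans (*-distribˡ-∑sublists qs _ _)
             (∑sublists-cong qs λ ys → sym (*-assoc _ _ _))) ⟩
      ∑± rs (λ r rs′ → ∑sublists qs (λ ys → p r q * detᴸ p rs′ ys * detᴸ x (q ∷ ys) cs))
        ≈⟨ ∑±-∑sublists qs rs _ ⟩
      ∑sublists qs (λ ys → ∑± rs (λ r rs′ → p r q * detᴸ p rs′ ys * detᴸ x (q ∷ ys) cs))
        ≈⟨ ∑sublists-cong qs (λ ys → *-distribʳ-∑± rs _ _) ⟨
      ∑sublists qs (λ ys → detᴸ p rs (q ∷ ys) * detᴸ x (q ∷ ys) cs) ∎))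
    where
    inner : ∀ rs → ∑± cs (λ s cs′ → x q s * detᴸ (λ r s → ∑∈ qs (λ q → p r q * x q s)) rs cs′) ≈
                   ∑sublists qs (λ ys → detᴸ p rs ys * detᴸ x (q ∷ ys) cs)
    inner rs = begin
      ∑± cs (λ s cs′ → x q s * detᴸ (λ r s → ∑∈ qs (λ q → p r q * x q s)) rs cs′)
        ≈⟨ ∑±-cong cs (λ s cs′ → trans (*-congˡ (cauchyBinet p x qs rs cs′))
             (trans (*-distribˡ-∑sublists qs _ _) (∑sublists-cong qs λ ys → x∙yz≈y∙xz _ _ _))) ⟩
      ∑± cs (λ s cs′ → ∑sublists qs (λ ys → detᴸ p rs ys * (x q s * detᴸ x ys cs′)))
        ≈⟨ ∑±-∑sublists qs cs _ ⟩
      ∑sublists qs (λ ys → ∑± cs (λ s cs′ → detᴸ p rs ys * (x q s * detᴸ x ys cs′)))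
        ≈⟨ ∑sublists-cong qs (λ ys → trans (*-congˡ (detᴸ-expandRow x q ys cs)) (*-distribˡ-∑± cs _ _)) ⟨
      ∑sublists qs (λ ys → detᴸ p rs ys * detᴸ x (q ∷ ys) cs) ∎

  -- Signs and block decompositions

  neg^ : ℕ → Carrier → Carrier
  neg^ zero    x = x
  neg^ (suc k) x = - neg^ k x

  neg^-cong : ∀ k {x y} → x ≈ y → neg^ k x ≈ neg^ k y
  neg^-cong zero    x≈y = x≈y
  neg^-cong (suc k) x≈y = -‿cong (neg^-cong k x≈y)

  neg^-+ : ∀ j k x → neg^ (j ℕ.+ k) x ≡ neg^ j (neg^ k x)
  neg^-+ zero    k x = ≡.refl
  neg^-+ (suc j) k x = ≡.cong -_ (neg^-+ j k x)

  neg^-+≡ : ∀ {i} j k x → i ≡ j ℕ.+ k → neg^ i x ≡ neg^ j (neg^ k x)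
  neg^-+≡ j k x ≡.refl = neg^-+ j k x

  neg^-neg : ∀ k x → neg^ k (- x) ≡ - neg^ k x
  neg^-neg zero    x = ≡.refl
  neg^-neg (suc k) x = ≡.cong -_ (neg^-neg k x)

  neg^-- : ∀ k x y → neg^ k (x - y) ≈ neg^ k x - neg^ k y
  neg^-- zero    x y = refl
  neg^-- (suc k) x y = trans (-‿cong (neg^-- k x y)) (-+-distrib _ _)

  neg^-0 : ∀ k → neg^ k 0# ≈ 0#
  neg^-0 zero    = refl
  neg^-0 (suc k) = trans (-‿cong (neg^-0 k)) -0#≈0#

  neg^-*ˡ : ∀ k x y → neg^ k x * y ≈ neg^ k (x * y)
  neg^-*ˡ zero    x y = refl
  neg^-*ˡ (suc k) x y = trans (sym (-‿distribˡ-* _ _)) (-‿cong (neg^-*ˡ k x y))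

  neg^-*ʳ : ∀ k x y → x * neg^ k y ≈ neg^ k (x * y)
  neg^-*ʳ k x y = trans (*-comm _ _) (trans (neg^-*ˡ k y x) (neg^-cong k (*-comm y x)))

  -- Each `ys` is one entry shorter than `xs`, so all signs under the sum agree, and the outer minus
  -- supplies the missing one.
  ∑±-neg^length : (xs : List A) (f : A → List A → Carrier) →
                  - ∑± xs (λ y ys → neg^ (length ys) (f y ys)) ≈ neg^ (length xs) (∑± xs f)
  ∑±-neg^length []       f = -0#≈0#
  ∑±-neg^length (x ∷ xs) f = -‿cong (begin
    neg^ (length xs) (f x xs) - ∑± xs (λ y ys → - neg^ (length ys) (f y (x ∷ ys)))
      ≈⟨ +-congˡ (-‿cong (trans (∑±-neg xs _) (∑±-neg^length xs _))) ⟩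
    neg^ (length xs) (f x xs) - neg^ (length xs) (∑± xs (λ y ys → f y (x ∷ ys)))
      ≈⟨ neg^-- (length xs) _ _ ⟨
    neg^ (length xs) (f x xs - ∑± xs (λ y ys → f y (x ∷ ys))) ∎)

  module _ {B : Set b} (P : B → Bool) where

    open Splitting P

    -- On the left the sign of `y` counts all entries before it, on the right only those in `P`. The
    -- difference is the number of entries outside `P` before `y`, which is what `crossings` loses
    -- when `y` is removed.
    ∑±-split : (h : B → Carrier) → (∀ x → P x ≡ false → h x ≈ 0#) →
               (F G : List B → Carrier) (xs : List B) →
               ∑± xs (λ y ys → h y * neg^ (crossings ys) (F (inP ys) * G (outP ys))) ≈
               neg^ (crossings xs) (∑± (inP xs) (λ y ys → h y * F ys) * G (outP xs))
    ∑±-split h h≈0 F G []       = sym (zeroˡ _)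
    ∑±-split h h≈0 F G (x ∷ xs) with P x in Px
    ... | true = begin
      h x * neg^ k (F (inP xs) * G (outP xs))
        - ∑± xs (λ y ys → h y * neg^ (crossings ys) (F (x ∷ inP ys) * G (outP ys)))
        ≈⟨ +-cong (trans (neg^-*ʳ k _ _) (neg^-cong k (sym (*-assoc _ _ _))))
             (-‿cong (∑±-split h h≈0 (F ∘ (x ∷_)) G xs)) ⟩
      neg^ k (h x * F (inP xs) * G (outP xs))
        - neg^ k (∑± (inP xs) (λ y ys → h y * F (x ∷ ys)) * G (outP xs))
        ≈⟨ neg^-- k _ _ ⟨
      neg^ k (h x * F (inP xs) * G (outP xs) - ∑± (inP xs) (λ y ys → h y * F (x ∷ ys)) * G (outP xs))
        ≈⟨ neg^-cong k ([y-z]x≈yx-zx _ _ _) ⟨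
      neg^ k ((h x * F (inP xs) - ∑± (inP xs) (λ y ys → h y * F (x ∷ ys))) * G (outP xs)) ∎
      where k = crossings xs
    ... | false = begin
      h x * _ - ∑± xs (λ y ys → h y * _)
        ≈⟨ +-cong (trans (*-congʳ (h≈0 x Px)) (zeroˡ _))
             (-‿cong (∑±-cong xs λ y ys → *-congˡ (move ys))) ⟩
      0# - ∑± xs (λ y ys → h y * neg^ (crossings ys) (F′ (inP ys) * G (x ∷ outP ys)))
        ≈⟨ trans (+-identityˡ _) (-‿cong (∑±-split h h≈0 F′ (G ∘ (x ∷_)) xs)) ⟩
      - neg^ k (∑± (inP xs) (λ y ys → h y * F′ ys) * G (x ∷ outP xs))
        ≡⟨ neg^-neg k _ ⟨
      neg^ k (- (∑± (inP xs) (λ y ys → h y * F′ ys) * G (x ∷ outP xs)))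
        ≈⟨ neg^-cong k (trans (-‿distribˡ-* _ _) (*-congʳ (trans
             (-‿cong (∑±-cong (inP xs) λ y ys → neg^-*ʳ (length ys) _ _))
             (∑±-neg^length (inP xs) _)))) ⟩
      neg^ k (neg^ j (∑± (inP xs) (λ y ys → h y * F ys)) * G (x ∷ outP xs))
        ≈⟨ neg^-cong k (neg^-*ˡ j _ _) ⟩
      neg^ k (neg^ j (∑± (inP xs) (λ y ys → h y * F ys) * G (x ∷ outP xs)))
        ≡⟨ neg^-+≡ k j _ (ℕ.+-comm j k) ⟨
      neg^ (j ℕ.+ k) (∑± (inP xs) (λ y ys → h y * F ys) * G (x ∷ outP xs)) ∎
      where
      k = crossings xs
      j = length (inP xs)
      -- The entry `x` outside `P` crosses every member of `P` that remains behind it. Moving this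
      -- sign into `F` restores the form of the induction hypothesis.
      F′ : List B → Carrier
      F′ ys = neg^ (length ys) (F ys)
      move : ∀ ys → neg^ (length (inP ys) ℕ.+ crossings ys) (F (inP ys) * G (x ∷ outP ys)) ≈
                    neg^ (crossings ys) (F′ (inP ys) * G (x ∷ outP ys))
      move ys = begin
        neg^ (length (inP ys) ℕ.+ crossings ys) (F (inP ys) * G (x ∷ outP ys))
          ≡⟨ neg^-+≡ (crossings ys) (length (inP ys)) _ (ℕ.+-comm (length (inP ys)) _) ⟩
        neg^ (crossings ys) (neg^ (length (inP ys)) (F (inP ys) * G (x ∷ outP ys)))
          ≈⟨ neg^-cong (crossings ys) (neg^-*ˡ (length (inP ys)) _ _) ⟨
        neg^ (crossings ys) (F′ (inP ys) * G (x ∷ outP ys)) ∎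

    -- Columns in `P` are zero, so the determinant vanishes unless there are none. The factor
    -- `ifEmpty` is the determinant of a first block without rows, and the sign is added to match
    -- the base case of `detᴸ-blocks`.
    detᴸ-outP : (e : A → B → Carrier) → (∀ r s → P s ≡ true → e r s ≈ 0#) → ∀ rs cs →
               detᴸ e rs cs ≈ neg^ (crossings cs) (ifEmpty (inP cs) * detᴸ e rs (outP cs))
    detᴸ-outP e e≈0 rs []       = sym (*-identityˡ _)
    detᴸ-outP e e≈0 rs (s ∷ cs) with P s in Ps
    ... | true  = trans (∑±-zero rs λ r _ → trans (*-congʳ (e≈0 r s Ps)) (zeroˡ _))
                    (sym (trans (neg^-cong (crossings cs) (zeroˡ _)) (neg^-0 (crossings cs))))
    ... | false = begin
      ∑± rs (λ r rs′ → e r s * detᴸ e rs′ cs)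
        ≈⟨ ∑±-cong rs (λ r rs′ → *-congˡ (trans (detᴸ-outP e e≈0 rs′ cs) (sym (neg^-*ˡ k _ _)))) ⟩
      ∑± rs (λ r rs′ → e r s * (neg^ k (ifEmpty (inP cs)) * detᴸ e rs′ (outP cs)))
        ≈⟨ ∑±-cong rs (λ r rs′ → x∙yz≈y∙xz _ _ _) ⟩
      ∑± rs (λ r rs′ → neg^ k (ifEmpty (inP cs)) * (e r s * detᴸ e rs′ (outP cs)))
        ≈⟨ *-distribˡ-∑± rs _ _ ⟨
      neg^ k (ifEmpty (inP cs)) * detᴸ e rs (s ∷ outP cs)
        ≈⟨ *-congʳ (trans (reflexive (neg^-+ (length (inP cs)) k _)) (neg^-ifEmpty (inP cs))) ⟨
      neg^ (length (inP cs) ℕ.+ k) (ifEmpty (inP cs)) * detᴸ e rs (s ∷ outP cs)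
        ≈⟨ neg^-*ˡ (length (inP cs) ℕ.+ k) _ _ ⟩
      neg^ (length (inP cs) ℕ.+ k) (ifEmpty (inP cs) * detᴸ e rs (s ∷ outP cs)) ∎
      where
      k = crossings cs
      -- The extra sign is trivial for an empty list and falls on 0 otherwise.
      neg^-ifEmpty : ∀ xs → neg^ (length xs) (neg^ k (ifEmpty xs)) ≈ neg^ k (ifEmpty xs)
      neg^-ifEmpty []       = refl
      neg^-ifEmpty (x ∷ xs) = trans (neg^-cong (length (x ∷ xs)) (neg^-0 k))
        (trans (neg^-0 (length (x ∷ xs))) (sym (neg^-0 k)))

    -- Expand along the rows of the first block one at a time; each meets only columns in `P`. The
    -- blocks need not be square, since `detᴸ` is 0 on unequal lengths.
    detᴸ-blocks : (e : A → B → Carrier) (f : C → A) (g : E → A) →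
      (∀ r s → P s ≡ false → e (f r) s ≈ 0#) → (∀ r s → P s ≡ true → e (g r) s ≈ 0#) →
      ∀ rs rs′ cs →
      detᴸ e (map f rs ++ map g rs′) cs ≈
      neg^ (crossings cs) (detᴸ (λ r → e (f r)) rs (inP cs) * detᴸ (λ r → e (g r)) rs′ (outP cs))
    detᴸ-blocks e f g f≈0 g≈0 [] rs′ cs = trans (detᴸ-mapˡ g e rs′ cs) (trans (detᴸ-outP _ g≈0 rs′ cs)
      (neg^-cong (crossings cs) (*-congʳ (detᴸ-[] (λ r → e (f r)) (inP cs)))))
      where
      detᴸ-[] : (e : C → B → Carrier) (cs : List B) → ifEmpty cs ≈ detᴸ e [] cs
      detᴸ-[] e []       = refl
      detᴸ-[] e (_ ∷ _) = refl
    detᴸ-blocks e f g f≈0 g≈0 (r ∷ rs) rs′ cs = begin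
      detᴸ e (f r ∷ map f rs ++ map g rs′) cs
        ≈⟨ detᴸ-expandRow e (f r) (map f rs ++ map g rs′) cs ⟩
      ∑± cs (λ s cs′ → e (f r) s * detᴸ e (map f rs ++ map g rs′) cs′)
        ≈⟨ ∑±-cong cs (λ s cs′ → *-congˡ (detᴸ-blocks e f g f≈0 g≈0 rs rs′ cs′)) ⟩
      ∑± cs (λ s cs′ → e (f r) s * neg^ (crossings cs′) (d (inP cs′) * d′ (outP cs′)))
        ≈⟨ ∑±-split (e (f r)) (f≈0 r) d d′ cs ⟩
      neg^ (crossings cs) (∑± (inP cs) (λ s cs′ → e (f r) s * d cs′) * d′ (outP cs))
        ≈⟨ neg^-cong (crossings cs) (*-congʳ (detᴸ-expandRow (λ r → e (f r)) r rs (inP cs))) ⟨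
      neg^ (crossings cs) (detᴸ (λ r → e (f r)) (r ∷ rs) (inP cs) * d′ (outP cs)) ∎
      where
      d d′ : List B → Carrier
      d  = detᴸ (λ r → e (f r)) rs
      d′ = detᴸ (λ r → e (g r)) rs′

  module _ {B : Set b} (v : B → Fin n) where

    open Word v

    -- `ρ` lists the letters not yet split off, in increasing order, so that `ρ zero` is least and
    -- `inv-split` turns crossings into inversions. The induction passes to `ρ ∘ suc`; the
    -- application takes `ρ` to be the identity.
    detᴸ-letterBlocks :
      (ρ : Fin m → Fin n) → (∀ {i j} → i Fin.< j → ρ i Fin.< ρ j) →
      (e : Fin m × E → B → Carrier) → (∀ i d s → v s ≢ ρ i → e (i , d) s ≈ 0#) →
      (K : Fin m → List E) → ∀ cs → All (λ s → ∃ λ i → v s ≡ ρ i) cs →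
      detᴸ e (taggedRows K) cs ≈
      neg^ (inv cs) (∏ (λ i → detᴸ (λ d → e (i , d)) (K i) (filterᵇ (isLetter (ρ i)) cs)))
    detᴸ-letterBlocks {m = zero}  ρ ρ-mono e e≈0 K []       []             = refl
    detᴸ-letterBlocks {m = zero}  ρ ρ-mono e e≈0 K (s ∷ cs) ((() , _) ∷ _)
    detᴸ-letterBlocks {m = suc m} ρ ρ-mono e e≈0 K cs       letters        = begin
      detᴸ e (taggedRows K) cs
        ≡⟨ ≡.cong (λ rs → detᴸ e rs cs) (taggedRows-suc K) ⟩
      detᴸ e (map (zero ,_) (K zero) ++ map (map₁ suc) (taggedRows (K ∘ suc))) cs
        ≈⟨ detᴸ-blocks (isLetter s₀) e (zero ,_) (map₁ suc)
             (λ d s eq → e≈0 zero d s (isLetter-false s₀ s eq))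
             (λ (i , d) s eq → e≈0 (suc i) d s λ vs≡ → s₀≢ i (≡.trans (≡.sym (isLetter-true s₀ s eq)) vs≡))
             (K zero) (taggedRows (K ∘ suc)) cs ⟩
      neg^ k (detᴸ (λ d → e (zero , d)) (K zero) (inP cs)
        * detᴸ (λ r → e (map₁ suc r)) (taggedRows (K ∘ suc)) (outP cs))
        ≈⟨ neg^-cong k (*-congˡ (detᴸ-letterBlocks (ρ ∘ suc) (ρ-mono ∘ ℕ.s≤s) (λ r → e (map₁ suc r))
             (λ i → e≈0 (suc i)) (K ∘ suc) (outP cs) (outP-letters s₀ ρ ≡.refl cs letters))) ⟩
      neg^ k (detᴸ (λ d → e (zero , d)) (K zero) (inP cs)
        * neg^ (inv (outP cs)) (∏ (λ i → block (suc i) (outP cs))))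
        ≈⟨ neg^-cong k (neg^-*ʳ (inv (outP cs)) _ _) ⟩
      neg^ k (neg^ (inv (outP cs)) (detᴸ (λ d → e (zero , d)) (K zero) (inP cs)
        * ∏ (λ i → block (suc i) (outP cs))))
        ≡⟨ neg^-+≡ k _ _ (inv-split s₀ cs (All.map least letters)) ⟨
      neg^ (inv cs) (detᴸ (λ d → e (zero , d)) (K zero) (inP cs) * ∏ (λ i → block (suc i) (outP cs)))
        ≈⟨ neg^-cong (inv cs) (*-congˡ (∏-cong λ i → reflexive
             (≡.cong (detᴸ (λ d → e (suc i , d)) (K (suc i))) (filter-outP s₀ (ρ (suc i)) (s₀≢ i) cs)))) ⟩
      neg^ (inv cs) (∏ (λ i → block i cs)) ∎
      where
      s₀ = ρ zero
      open Splitting (isLetter s₀)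
      k = crossings cs
      block : Fin (suc m) → List B → Carrier
      block i xs = detᴸ (λ d → e (i , d)) (K i) (filterᵇ (isLetter (ρ i)) xs)
      s₀≢ : ∀ i → s₀ ≢ ρ (suc i)
      s₀≢ i eq = ℕ.<-irrefl (≡.cong Fin.toℕ eq) (ρ-mono ℕ.z<s)
      least : ∀ {x} → (∃ λ i → v x ≡ ρ i) → s₀ Fin.≤ v x
      least (zero  , vx≡) = ℕ.≤-reflexive (≡.cong Fin.toℕ (≡.sym vx≡))
      least (suc i , vx≡) = ℕ.≤-trans (ℕ.<⇒≤ (ρ-mono {zero} {suc i} ℕ.z<s))
        (ℕ.≤-reflexive (≡.cong Fin.toℕ (≡.sym vx≡)))

-- Evaluation of polynomials as a ring homomorphism

module EvaluationHomomorphism (N : ℕ) (R : CommutativeRing c ℓ) (x : Fin N → CommutativeRing.Carrier R) where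

  open Polynomial N using (Poly) renaming (commutativeRing to polynomialRing)
  module 𝒫 where
    open CommutativeRing polynomialRing public
    open SemiringSum semiring using (sum) public
    open SemiringExp semiring using (_^_) public
    open CommutativeMonoidSum *-commutativeMonoid using () renaming (sum to ∏) public
    open Determinant polynomialRing using (Matrix; det) public
  open CommutativeRing R hiding (zero)
  open Polynomial.Evaluation N R x
  open SemiringSum semiring using (sum; sum-cong-≋)
  open SemiringExp semiring using (_^_)
  open CommutativeMonoidSum *-commutativeMonoid using () renaming (sum to ∏)
  open Determinant R

  ⟦sum⟧ : (f : Fin n → Poly) → ⟦ 𝒫.sum f ⟧ ≡ sum (λ i → ⟦ f i ⟧)
  ⟦sum⟧ {n = zero}  f = ≡.refl
  ⟦sum⟧ {n = suc n} f = ≡.cong (⟦ f zero ⟧ +_) (⟦sum⟧ (f ∘ suc))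

  ⟦∏⟧ : (f : Fin n → Poly) → ⟦ 𝒫.∏ f ⟧ ≡ ∏ (λ i → ⟦ f i ⟧)
  ⟦∏⟧ {n = zero}  f = ≡.refl
  ⟦∏⟧ {n = suc n} f = ≡.cong (⟦ f zero ⟧ *_) (⟦∏⟧ (f ∘ suc))

  ⟦^⟧ : ∀ p k → ⟦ p 𝒫.^ k ⟧ ≡ ⟦ p ⟧ ^ k
  ⟦^⟧ p zero    = ≡.refl
  ⟦^⟧ p (suc k) = ≡.cong (⟦ p ⟧ *_) (⟦^⟧ p k)

  ⟦det⟧ : (A : 𝒫.Matrix n n) → ⟦ 𝒫.det A ⟧ ≈ det (λ i j → ⟦ A i j ⟧)
  ⟦det⟧ {n = zero}  A = refl
  ⟦det⟧ {n = suc n} A = trans (reflexive (⟦sum⟧ term)) (sum-cong-≋ λ i →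
    *-cong (reflexive (⟦^⟧ (𝒫.- 𝒫.1#) (toℕ i))) (*-congˡ {⟦ A i zero ⟧} (⟦det⟧ (λ r s → A (punchIn i r) (suc s)))))
    where
    term : Fin (suc n) → Poly
    term i = (𝒫.- 𝒫.1#) 𝒫.^ toℕ i 𝒫.* (A i zero 𝒫.* 𝒫.det (λ r s → A (punchIn i r) (suc s)))

-- The matrix of powers and its minors

module VariableMatrix (R : CommutativeRing c ℓ) where

  open CommutativeRing R hiding (zero)
  open RingProperties ring
  open SemiringSum semiring using (sum; sum-cong-≋; *-distribˡ-sum; sum-remove)
  open SemiringExp semiring using (_^_)
  open CommutativeMonoidSum *-commutativeMonoid using () 
    renaming (sum to ∏; sum-cong-≋ to ∏-cong; ∑-distrib-+ to ∏-distrib-*)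
  open Determinant R using (Matrix; det)
  open Alternant R using (sgn; Δ; powers; monomial; alternant-monic; monomial-monic; eval-monomial; ∑-zero)
    renaming (det-cong to detᴹ-cong)
  open ListDeterminant R
  open SetoidReasoning setoid

  neg-sum : (f : Fin n → Carrier) → - sum f ≈ sum (λ i → - f i)
  neg-sum f = trans (sym (-1*x≈-x _)) (trans (*-distribˡ-sum (- 1#) f) (sum-cong-≋ λ i → -1*x≈-x (f i)))

  -- Bridge to the Laplace expansion of `det`: removing the entry at `i` leaves the family reindexed
  -- by `punchIn i`.
  ∑±-tabulate : (f : Fin (suc n) → A) (F : A → List A → Carrier) →
                ∑± (List.tabulate f) F ≈ sum (λ i → sgn i * F (f i) (List.tabulate (f ∘ punchIn i)))
  ∑±-tabulate {n = zero}  f F = +-cong (sym (*-identityˡ _)) -0#≈0#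
  ∑±-tabulate {n = suc n} {A = A} f F = +-cong (sym (*-identityˡ _)) (begin
    - ∑± (List.tabulate (f ∘ suc)) (λ y ys → F y (f zero ∷ ys))
      ≈⟨ -‿cong (∑±-tabulate (f ∘ suc) (λ y ys → F y (f zero ∷ ys))) ⟩
    - sum (λ i → sgn i * t i)
      ≈⟨ neg-sum (λ i → sgn i * t i) ⟩
    sum (λ i → - (sgn i * t i))
      ≈⟨ sum-cong-≋ (λ i → trans (-‿distribˡ-* (sgn i) (t i)) (*-congʳ {t i} (sym (-1*x≈-x (sgn i))))) ⟩
    sum (λ i → sgn (suc i) * t i) ∎)
    where
    t : Fin (suc n) → Carrier
    t i = F (f (suc i)) (List.tabulate (f ∘ punchIn (suc i)))

  detᴸ-tabulate : (e : A → B → Carrier) (f : Fin n → A) (g : Fin n → B) →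
                  detᴸ e (List.tabulate f) (List.tabulate g) ≈ det (λ i j → e (f i) (g j))
  detᴸ-tabulate {n = zero}  e f g = refl
  detᴸ-tabulate {n = suc n} e f g = trans
    (∑±-tabulate f (λ r rs → e r (g zero) * detᴸ e rs (List.tabulate (g ∘ suc))))
    (sum-cong-≋ λ i → *-congˡ {sgn i} (*-congˡ {e (f i) (g zero)} (detᴸ-tabulate e (f ∘ punchIn i) (g ∘ suc))))

  detᴸ-congᶜ : {e e′ : A → B → Carrier} → ∀ rs cs → All (λ s → ∀ r → e r s ≈ e′ r s) cs →
               detᴸ e rs cs ≈ detᴸ e′ rs cs
  detᴸ-congᶜ rs []       []       = refl
  detᴸ-congᶜ rs (s ∷ cs) (p ∷ ps) = ∑±-cong rs λ r rs′ → *-cong (p r) (detᴸ-congᶜ rs′ cs ps)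

  ∏-zero : (f : Fin n → Carrier) (i : Fin n) → f i ≈ 0# → ∏ f ≈ 0#
  ∏-zero f zero    fi≈0 = trans (*-congʳ fi≈0) (zeroˡ _)
  ∏-zero f (suc i) fi≈0 = trans (*-congˡ (∏-zero (f ∘ suc) i fi≈0)) (zeroʳ _)

  sum-only : (f : Fin n → Carrier) (i : Fin n) → (∀ j → j ≢ i → f j ≈ 0#) → sum f ≈ f i
  sum-only {n = suc n} f i f≈0 = trans (sum-remove {i = i} f)
    (trans (+-congˡ (∑-zero λ j → f≈0 (punchIn i j) (Fin.punchInᵢ≢i i j))) (+-identityʳ _))

  ∑∈-tabulate : (f : Fin n → A) (h : A → Carrier) → ∑∈ (List.tabulate f) h ≈ sum (h ∘ f)
  ∑∈-tabulate {n = zero}  f h = refl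
  ∑∈-tabulate {n = suc n} f h = +-congˡ (∑∈-tabulate (f ∘ suc) h)

  ∑∈-++ : (xs ys : List A) (h : A → Carrier) → ∑∈ (xs ++ ys) h ≈ ∑∈ xs h + ∑∈ ys h
  ∑∈-++ []       ys h = sym (+-identityˡ _)
  ∑∈-++ (x ∷ xs) ys h = trans (+-congˡ (∑∈-++ xs ys h)) (sym (+-assoc _ _ _))

  ∑∈-concatTabulate : (K : Fin n → List A) (h : A → Carrier) →
                      ∑∈ (concatTabulate K) h ≈ sum (λ i → ∑∈ (K i) h)
  ∑∈-concatTabulate {n = zero}  K h = refl
  ∑∈-concatTabulate {n = suc n} K h = trans (∑∈-++ (K zero) _ h) (+-congˡ (∑∈-concatTabulate (K ∘ suc) h))

  ∑∈-combine : (h : Fin (n ℕ.* ν) → Carrier) →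
               ∑∈ (List.allFin (n ℕ.* ν)) h ≈ sum {n} (λ s → sum {ν} (λ k → h (combine s k)))
  ∑∈-combine {n = n} h = begin
    ∑∈ (List.tabulate id) h
      ≡⟨ ≡.cong (λ L → ∑∈ L h) (tabulate-combine n id) ⟩
    ∑∈ (concatTabulate (λ s → List.tabulate (combine {n} s))) h
      ≈⟨ ∑∈-concatTabulate (λ s → List.tabulate (combine {n} s)) h ⟩
    sum {n} (λ s → ∑∈ (List.tabulate (combine s)) h)
      ≈⟨ sum-cong-≋ (λ (s : Fin n) → ∑∈-tabulate (combine s) h) ⟩
    sum {n} (λ s → sum (λ k → h (combine s k))) ∎

  -- The product form of the Vandermonde determinant, from which positivity can be read off.
  alternant-vandermonde : (y : Fin m → Carrier) → det (powers toℕ y) ≈ Δ y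
  alternant-vandermonde y = trans (detᴹ-cong λ i j → sym (eval-monomial (toℕ i) (y j)))
    (alternant-monic (monomial ∘ toℕ) y (monomial-monic ∘ toℕ))

  module _ (v : Vec (Fin n) N) (ν : ℕ) (x : Fin N → Carrier) where

    open Minors v ν
    open Word (lookup v)
    open Polynomial.Evaluation N R x
    open EvaluationHomomorphism N R x
    open Schur N using (partialSchur; schur; exponents; variables; numerator; denominator; denominator∣numerator)
    open RawMagmaDefinitions (CommutativeRing.*-rawMagma (Polynomial.commutativeRing N)) using (module _∣ʳ_)

    blockEntry : Fin n × Fin ν → Fin N → Carrier
    blockEntry (s , k) l = if isLetter s l then x l ^ toℕ k else 0#

    blockEntry-letter : ∀ s k l → isLetter s l ≡ true → blockEntry (s , k) l ≈ x l ^ toℕ k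
    blockEntry-letter s k l eq rewrite eq = refl

    blockEntry-other : ∀ s k l → lookup v l ≢ s → blockEntry (s , k) l ≈ 0#
    blockEntry-other s k l vl≢s with lookup v l Fin.≟ s
    ... | yes vl≡s = ⊥-elim (vl≢s vl≡s)
    ... | no _     = refl

    variableMatrix : Fin (n ℕ.* ν) → Fin N → Carrier
    variableMatrix q = blockEntry (remQuot ν q)

    points : (s : Fin n) → Fin (occurrences v s) → Carrier
    points s j = x (lookup (elements (positions v s)) j)

    power : ℕ → Fin N → Carrier
    power k l = x l ^ k

    detᴸ-letter : (s : Fin n) (ks : List (Fin ν)) →
      detᴸ (λ k → blockEntry (s , k)) ks (filterᵇ (isLetter s) (List.allFin N)) ≈
      detᴸ power (map toℕ ks) (elementList (positions v s))
    detᴸ-letter s ks = begin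
      detᴸ (λ k → blockEntry (s , k)) ks (filterᵇ (isLetter s) (List.allFin N))
        ≈⟨ detᴸ-congᶜ ks _ (All.map (λ {l} Tl k → blockEntry-letter s k l (T⇒≡ Tl))
             (All.all-filter (T? ∘ isLetter s) (List.allFin N))) ⟩
      detᴸ (λ k → power (toℕ k)) ks (filterᵇ (isLetter s) (List.allFin N))
        ≈⟨ detᴸ-mapˡ toℕ power ks (filterᵇ (isLetter s) (List.allFin N)) ⟨
      detᴸ power (map toℕ ks) (filterᵇ (isLetter s) (List.allFin N))
        ≡⟨ ≡.cong (detᴸ power (map toℕ ks)) (elementList-positions v s) ⟨
      detᴸ power (map toℕ ks) (elementList (positions v s)) ∎
      where
      T⇒≡ : ∀ {b} → T b → b ≡ true
      T⇒≡ {true} _ = ≡.refl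

    -- Holds for every 𝔷, whether or not the blocks are square, so membership in ℨ is considered
    -- only afterwards, one factor at a time.
    detᴸ-variableMatrix : ∀ 𝔷 → detᴸ variableMatrix (elementList 𝔷) (List.allFin N) ≈
      neg^ (inv (List.allFin N)) (∏ (λ s →
        detᴸ power (map toℕ (elementList (fibre 𝔷 s))) (elementList (positions v s))))
    detᴸ-variableMatrix 𝔷 = begin
      detᴸ variableMatrix (elementList 𝔷) cs
        ≡⟨ ≡.cong (λ rs → detᴸ variableMatrix rs cs) (elementList-taggedRows v ν 𝔷) ⟩
      detᴸ variableMatrix (map (uncurry combine) rows) cs
        ≈⟨ detᴸ-mapˡ (uncurry combine) variableMatrix rows cs ⟩
      detᴸ (λ (s , k) → variableMatrix (combine s k)) rows cs
        ≈⟨ detᴸ-cong (λ (s , k) l → reflexive (≡.cong (λ q → blockEntry q l) (Fin.remQuot-combine s k))) rows cs ⟩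
      detᴸ blockEntry rows cs
        ≈⟨ detᴸ-letterBlocks (lookup v) id id blockEntry blockEntry-other (λ s → elementList (fibre 𝔷 s)) cs
             (All.tabulate⁺ λ l → lookup v l , ≡.refl) ⟩
      neg^ (inv cs) (∏ (λ s → detᴸ (λ k → blockEntry (s , k)) (elementList (fibre 𝔷 s)) (filterᵇ (isLetter s) cs)))
        ≈⟨ neg^-cong (inv cs) (∏-cong λ s → detᴸ-letter s (elementList (fibre 𝔷 s))) ⟩
      neg^ (inv cs) (∏ (λ s → detᴸ power (map toℕ (elementList (fibre 𝔷 s))) (elementList (positions v s)))) ∎
      where
      cs = List.allFin N
      rows = taggedRows (λ s → elementList (fibre 𝔷 s))

    detᴸ-∉ℨ : ∀ 𝔷 s → ∣ fibre 𝔷 s ∣ ≢ occurrences v s →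
      detᴸ power (map toℕ (elementList (fibre 𝔷 s))) (elementList (positions v s)) ≈ 0#
    detᴸ-∉ℨ 𝔷 s ≢ = detᴸ-length≢ power
      (map toℕ (elementList (fibre 𝔷 s))) (elementList (positions v s)) λ eq → ≢ (≡.trans
      (≡.sym (≡.trans (List.length-map toℕ (elementList (fibre 𝔷 s))) (length-elementList (fibre 𝔷 s))))
      (≡.trans eq (length-elementList (positions v s))))

    -- The divisibility witness that defines `schur` is an identity of polynomials; it is evaluated
    -- as a product, so nothing is divided at the points.
    ⟦schur⟧ : ∀ 𝔷 (𝔷∈ℨ : 𝔷 ∈ℨ) s →
      detᴸ power (map toℕ (elementList (fibre 𝔷 s))) (elementList (positions v s)) ≈
      Δ (points s) * ⟦ schur (positions v s) (Λ 𝔷 𝔷∈ℨ s) ⟧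
    ⟦schur⟧ 𝔷 𝔷∈ℨ s = begin
      detᴸ power (map toℕ (elementList (fibre 𝔷 s))) (elementList (positions v s))
        ≡⟨ ≡.cong₂ (detᴸ power) (≡.sym (exponents-Λ v ν 𝔷 𝔷∈ℨ s)) (toList-tabulate (elements (positions v s))) ⟩
      detᴸ power (List.tabulate (exponents λs)) (List.tabulate (lookup (elements J)))
        ≈⟨ detᴸ-tabulate power (exponents λs) (lookup (elements J)) ⟩
      det (λ i j → points s j ^ exponents λs i)
        ≈⟨ detᴹ-cong (λ i j → reflexive (⟦^⟧ (variables J j) (exponents λs i))) ⟨
      det (λ i j → ⟦ numerator J λs i j ⟧)
        ≈⟨ ⟦det⟧ (numerator J λs) ⟨
      ⟦ 𝒫.det (numerator J λs) ⟧
        ≈⟨ ⟦⟧-cong (_∣ʳ_.equality (denominator∣numerator J λs)) ⟨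
      ⟦ schur J λs ⟧ * ⟦ 𝒫.det (denominator J) ⟧
        ≈⟨ *-comm _ _ ⟩
      ⟦ 𝒫.det (denominator J) ⟧ * ⟦ schur J λs ⟧
        ≈⟨ *-congʳ (⟦det⟧ (denominator J)) ⟩
      det (λ i j → ⟦ denominator J i j ⟧) * ⟦ schur J λs ⟧
        ≈⟨ *-congʳ (detᴹ-cong λ i j → reflexive (⟦^⟧ (variables J j) (toℕ i))) ⟩
      det (powers toℕ (points s)) * ⟦ schur J λs ⟧
        ≈⟨ *-congʳ (alternant-vandermonde (points s)) ⟩
      Δ (points s) * ⟦ schur J λs ⟧ ∎
      where
      J  = positions v s
      λs = Λ 𝔷 𝔷∈ℨ s

    vandermondes : Carrier
    vandermondes = ∏ (λ s → Δ (points s))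

    detᴸ-∈ℨ : ∀ 𝔷 (𝔷∈ℨ : 𝔷 ∈ℨ) → detᴸ variableMatrix (elementList 𝔷) (List.allFin N) ≈
      neg^ (inv (List.allFin N)) (vandermondes * ⟦ partialSchur (positions v) (Λ 𝔷 𝔷∈ℨ) ⟧)
    detᴸ-∈ℨ 𝔷 𝔷∈ℨ = trans (detᴸ-variableMatrix 𝔷) (neg^-cong (inv (List.allFin N)) (begin
      ∏ (λ s → detᴸ power (map toℕ (elementList (fibre 𝔷 s))) (elementList (positions v s)))
        ≈⟨ ∏-cong (⟦schur⟧ 𝔷 𝔷∈ℨ) ⟩
      ∏ (λ s → Δ (points s) * ⟦ schur (positions v s) (Λ 𝔷 𝔷∈ℨ s) ⟧)
        ≈⟨ ∏-distrib-* (λ s → Δ (points s)) (λ s → ⟦ schur (positions v s) (Λ 𝔷 𝔷∈ℨ s) ⟧) ⟩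
      vandermondes * ∏ (λ s → ⟦ schur (positions v s) (Λ 𝔷 𝔷∈ℨ s) ⟧)
        ≡⟨ ≡.cong (vandermondes *_) (⟦∏⟧ (λ s → schur (positions v s) (Λ 𝔷 𝔷∈ℨ s))) ⟨
      vandermondes * ⟦ partialSchur (positions v) (Λ 𝔷 𝔷∈ℨ) ⟧ ∎))

-- Signs and positivity in an ordered field

module OrderedFieldProperties (F : OrderedField c ℓ₁ ℓ₂) where

  open OrderedField F hiding (zero)
  open RingProperties ring
  open ListDeterminant commutativeRing using (neg^)
  open Alternant commutativeRing using (Δ; differences)
  open CommutativeMonoidSum *-commutativeMonoid using () renaming (sum to ∏)
  open IsStrictTotalOrder isStrictTotalOrder using (<-resp-≈)

  <-respˡ : ∀ {x y z} → x ≈ y → x < z → y < z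
  <-respˡ = proj₂ <-resp-≈
  <-respʳ : ∀ {x y z} → x ≈ y → z < x → z < y
  <-respʳ = proj₁ <-resp-≈

  x<y⇒0<y-x : ∀ {x y} → x < y → 0# < y - x
  x<y⇒0<y-x {x} x<y = <-respˡ (-‿inverseʳ x) (+-mono-< (- x) x<y)

  0<x⇒-x<0 : ∀ {x} → 0# < x → - x < 0#
  0<x⇒-x<0 {x} 0<x = <-respˡ (+-identityˡ _) (<-respʳ (-‿inverseʳ x) (+-mono-< (- x) 0<x))

  x<0⇒0<-x : ∀ {x} → x < 0# → 0# < - x
  x<0⇒0<-x {x} x<0 = <-respˡ (-‿inverseʳ x) (<-respʳ (+-identityˡ _) (+-mono-< (- x) x<0))

  0<1 : 0# < 1#
  0<1 with compare 0# 1#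
  ... | tri< lt _ _ = lt
  ... | tri≈ _ eq _ = ⊥-elim (1≉0 (sym eq))
  -- If 1 were negative, -1 would be positive, and so would its square, which is 1.
  ... | tri> _ _ gt = <-respʳ (trans (-1*x≈-x (- 1#)) (-‿involutive 1#)) (*-positive (x<0⇒0<-x gt) (x<0⇒0<-x gt))

  sign-positive : ∀ {x} → 0# < x → sign x ≡ 1ℤ
  sign-positive {x} 0<x with compare x 0#
  ... | tri< _ _ x≯0 = ⊥-elim (x≯0 0<x)
  ... | tri≈ _ _ x≯0 = ⊥-elim (x≯0 0<x)
  ... | tri> _ _ _   = ≡.refl

  sign-negative : ∀ {x} → x < 0# → sign x ≡ -1ℤ
  sign-negative {x} x<0 with compare x 0#
  ... | tri< _ _ _   = ≡.refl
  ... | tri≈ x≮0 _ _ = ⊥-elim (x≮0 x<0)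
  ... | tri> x≮0 _ _ = ⊥-elim (x≮0 x<0)

  sign-zero : ∀ {x} → x ≈ 0# → sign x ≡ 0ℤ
  sign-zero {x} x≈0 with compare x 0#
  ... | tri< _ x≉0 _ = ⊥-elim (x≉0 x≈0)
  ... | tri≈ _ _ _   = ≡.refl
  ... | tri> _ x≉0 _ = ⊥-elim (x≉0 x≈0)

  sign-cong : ∀ {x y} → x ≈ y → sign x ≡ sign y
  sign-cong {x} {y} x≈y with compare y 0#
  ... | tri< y<0 _ _ = sign-negative (<-respˡ (sym x≈y) y<0)
  ... | tri≈ _ y≈0 _ = sign-zero (trans x≈y y≈0)
  ... | tri> _ _ 0<y = sign-positive (<-respʳ (sym x≈y) 0<y)

  sign-- : ∀ x → sign (- x) ≡ -1ℤ ℤ.* sign x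
  sign-- x with compare x 0#
  ... | tri< x<0 _ _ = sign-positive (x<0⇒0<-x x<0)
  ... | tri≈ _ x≈0 _ = sign-zero (trans (-‿cong x≈0) -0#≈0#)
  ... | tri> _ _ 0<x = sign-negative (0<x⇒-x<0 0<x)

  sign-neg^ : ∀ k x → sign (neg^ k x) ≡ -1ℤ ℤ.^ k ℤ.* sign x
  sign-neg^ zero    x = ≡.sym (ℤ.*-identityˡ (sign x))
  sign-neg^ (suc k) x = ≡.trans (sign-- (neg^ k x))
    (≡.trans (≡.cong (-1ℤ ℤ.*_) (sign-neg^ k x)) (≡.sym (ℤ.*-assoc -1ℤ (-1ℤ ℤ.^ k) (sign x))))

  sign-*-positive : ∀ {t} x → 0# < t → sign (t * x) ≡ sign x
  sign-*-positive {t} x 0<t with compare x 0#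
  ... | tri< x<0 _ _ = sign-negative (<-respˡ (trans (-‿cong (sym (-‿distribʳ-* t x))) (-‿involutive _))
                         (0<x⇒-x<0 (*-positive 0<t (x<0⇒0<-x x<0))))
  ... | tri≈ _ x≈0 _ = sign-zero (trans (*-congˡ x≈0) (zeroʳ t))
  ... | tri> _ _ 0<x = sign-positive (*-positive 0<t 0<x)

  ∏-positive : (f : Fin n → Carrier) → (∀ i → 0# < f i) → 0# < ∏ f
  ∏-positive {n = zero}  f 0<f = 0<1
  ∏-positive {n = suc n} f 0<f = *-positive (0<f zero) (∏-positive (f ∘ suc) (0<f ∘ suc))

  Δ-positive : (y : Fin n → Carrier) → (∀ {i j} → i Fin.< j → y i < y j) → 0# < Δ y
  Δ-positive {n = zero}  y y-mono = 0<1
  Δ-positive {n = suc n} y y-mono = *-positive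
    (∏-positive (differences y) λ j → x<y⇒0<y-x (y-mono ℕ.z<s))
    (Δ-positive (y ∘ suc) λ i<j → y-mono (ℕ.s≤s i<j))

-- The determinant of the model matrix and its sign

module SignFormula (ℝ : RealNumbers c ℓ₁ ℓ₂) where

  open RealNumbers ℝ hiding (zero)
  open Model ℝ
  open SemiringSum semiring using (sum; sum-cong-≋)
  open VariableMatrix commutativeRing
  open ListDeterminant commutativeRing
  open OrderedFieldProperties orderedField
  open Alternant commutativeRing using (∑-zero)
  open CommutativeSemigroupProperties *-commutativeSemigroup using (x∙yz≈y∙xz)
  open RingProperties ring
  open SetoidReasoning setoid

  ∑⊆-cong : {f g : Subset m → Carrier} → (∀ p → f p ≈ g p) → ∑⊆ f ≈ ∑⊆ g
  ∑⊆-cong {m = zero}  f≈g = f≈g []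
  ∑⊆-cong {m = suc m} f≈g = +-cong (∑⊆-cong λ p → f≈g (outside ∷ p)) (∑⊆-cong λ p → f≈g (inside ∷ p))

  *-distribˡ-∑⊆ : (t : Carrier) (f : Subset m → Carrier) → t * ∑⊆ f ≈ ∑⊆ (λ p → t * f p)
  *-distribˡ-∑⊆ {m = zero}  t f = refl
  *-distribˡ-∑⊆ {m = suc m} t f = trans (distribˡ t _ _)
    (+-cong (*-distribˡ-∑⊆ t (λ p → f (outside ∷ p))) (*-distribˡ-∑⊆ t (λ p → f (inside ∷ p))))

  -‿∑⊆ : (f : Subset m → Carrier) → - ∑⊆ f ≈ ∑⊆ (λ p → - f p)
  -‿∑⊆ f = trans (sym (-1*x≈-x _)) (trans (*-distribˡ-∑⊆ (- 1#) f) (∑⊆-cong λ p → -1*x≈-x (f p)))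

  neg^-∑⊆ : ∀ k (f : Subset m → Carrier) → neg^ k (∑⊆ f) ≈ ∑⊆ (λ p → neg^ k (f p))
  neg^-∑⊆ zero    f = refl
  neg^-∑⊆ (suc k) f = trans (-‿cong (neg^-∑⊆ k f)) (-‿∑⊆ (λ p → neg^ k (f p)))

  -- Both sums branch on the first element, leaving it out before taking it in, so they agree term
  -- by term.
  ∑sublists-tabulate : (g : Fin m → A) (F : List A → Carrier) →
                       ∑sublists (List.tabulate g) F ≈ ∑⊆ (λ p → F (map g (elementList p)))
  ∑sublists-tabulate {m = zero}  g F = refl
  ∑sublists-tabulate {m = suc m} g F = +-cong
    (trans (∑sublists-tabulate (g ∘ suc) F)
      (∑⊆-cong λ p → reflexive (≡.cong F (shift p))))
    (trans (∑sublists-tabulate (g ∘ suc) (λ ys → F (g zero ∷ ys)))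
      (∑⊆-cong λ p → reflexive (≡.cong (λ ys → F (g zero ∷ ys)) (shift p))))
    where
    shift : ∀ p → map (g ∘ suc) (elementList p) ≡ map g (toList (Vec.map Fin.suc (elements p)))
    shift p = ≡.trans (List.map-∘ (elementList p)) (≡.cong (map g) (≡.sym (Vec.toList-map suc (elements p))))

  module _ (v : Vec (Fin n) N) (𝒫 : ParameterTensor N n ν) (x : Fin N → Carrier) where

    open Minors v ν
    open Schur N using (partialSchur)
    open Polynomial.Evaluation N commutativeRing x
    open Word (lookup v) using (inv)

    private
      X : Fin (n ℕ.* ν) → Fin N → Carrier
      X = variableMatrix v ν x
      is : List (Fin N)
      is = List.allFin N
      k = inv is
      V = vandermondes v ν x

    -- In column `l` of X all rows of letters other than `lookup v l` vanish, which leaves one sum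
    -- over k.
    modelMatrix-factors : ∀ i l →
      modelMatrix v 𝒫 x i l ≈ ∑∈ (List.allFin (n ℕ.* ν)) (λ q → asMatrix 𝒫 i q * X q l)
    modelMatrix-factors i l = sym (begin
      ∑∈ (List.allFin (n ℕ.* ν)) (λ q → asMatrix 𝒫 i q * X q l)
        ≈⟨ ∑∈-combine {n = n} (λ q → asMatrix 𝒫 i q * X q l) ⟩
      sum {n} (λ s → sum {ν} (λ k → asMatrix 𝒫 i (combine s k) * X (combine s k) l))
        ≈⟨ sum-cong-≋ (λ (s : Fin n) → sum-cong-≋ (λ (k : Fin ν) → reflexive
             (≡.cong (λ q → uncurry (𝒫 i) q * blockEntry v ν x q l) (Fin.remQuot-combine s k)))) ⟩
      sum {n} (λ s → sum {ν} (λ k → 𝒫 i s k * blockEntry v ν x (s , k) l))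
        ≈⟨ sum-only (λ s → sum {ν} (λ k → 𝒫 i s k * blockEntry v ν x (s , k) l)) (lookup v l)
             (λ s s≢ → ∑-zero (λ k → trans (*-congˡ (blockEntry-other v ν x s k l λ eq → s≢ (≡.sym eq)))
               (zeroʳ (𝒫 i s k)))) ⟩
      sum {ν} (λ k → 𝒫 i (lookup v l) k * blockEntry v ν x (lookup v l , k) l)
        ≈⟨ sum-cong-≋ (λ k → *-congˡ {𝒫 i (lookup v l) k} (blockEntry-letter v ν x (lookup v l) k l own)) ⟩
      modelMatrix v 𝒫 x i l ∎)
      where
      own : Word.isLetter (lookup v) (lookup v l) l ≡ true
      own with lookup v l Fin.≟ lookup v l
      ... | yes _  = ≡.refl
      ... | no neq = ⊥-elim (neq ≡.refl)

    summand : ∀ 𝔷 → detᴸ (asMatrix 𝒫) is (elementList 𝔷) * detᴸ X (elementList 𝔷) is ≈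
      neg^ k (V * restrict (𝔷 ∈ℨ?) λ 𝔷∈ℨ →
        det (columns (asMatrix 𝒫) 𝔷 (∣𝔷∣≡N 𝔷 𝔷∈ℨ)) * ⟦ partialSchur (positions v) (Λ 𝔷 𝔷∈ℨ) ⟧)
    summand 𝔷 with 𝔷 ∈ℨ?
    ... | yes 𝔷∈ℨ = begin
      D * detᴸ X (elementList 𝔷) is  ≈⟨ *-cong minor (detᴸ-∈ℨ v ν x 𝔷 𝔷∈ℨ) ⟩
      D′ * neg^ k (V * S)            ≈⟨ neg^-*ʳ k _ _ ⟩
      neg^ k (D′ * (V * S))          ≈⟨ neg^-cong k (x∙yz≈y∙xz D′ V S) ⟩
      neg^ k (V * (D′ * S))          ∎
      where
      D  = detᴸ (asMatrix 𝒫) is (elementList 𝔷)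
      D′ = det (columns (asMatrix 𝒫) 𝔷 (∣𝔷∣≡N 𝔷 𝔷∈ℨ))
      S  = ⟦ partialSchur (positions v) (Λ 𝔷 𝔷∈ℨ) ⟧
      minor : D ≈ D′
      minor = trans
        (reflexive (≡.cong (detᴸ (asMatrix 𝒫) is) (≡.sym (tabulate-cast (∣𝔷∣≡N 𝔷 𝔷∈ℨ) (elements 𝔷)))))
        (detᴸ-tabulate (asMatrix 𝒫) id (λ j → lookup (elements 𝔷) (Fin.cast (≡.sym (∣𝔷∣≡N 𝔷 𝔷∈ℨ)) j)))
    -- Some letter then has a block that is not square; its determinant is 0 and annihilates the
    -- product, in accordance with the value 0 of `restrict`.
    ... | no 𝔷∉ℨ with Fin.¬∀⟶∃¬ n _ (λ s → ∣ fibre 𝔷 s ∣ ℕ.≟ occurrences v s) 𝔷∉ℨ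
    ...   | s , ≢ = trans (*-congˡ (trans (detᴸ-variableMatrix v ν x 𝔷)
              (trans (neg^-cong k (∏-zero _ s (detᴸ-∉ℨ v ν x 𝔷 s ≢))) (neg^-0 k))))
              (trans (zeroʳ _) (sym (trans (neg^-cong k (zeroʳ V)) (neg^-0 k))))

    det-modelMatrix : det (modelMatrix v 𝒫 x) ≈ neg^ k (V * minorSchurSum v 𝒫 x)
    det-modelMatrix = begin
      det (modelMatrix v 𝒫 x)
        ≈⟨ detᴸ-tabulate (modelMatrix v 𝒫 x) id id ⟨
      detᴸ (modelMatrix v 𝒫 x) is is
        ≈⟨ detᴸ-cong modelMatrix-factors is is ⟩
      detᴸ (λ i l → ∑∈ (List.allFin (n ℕ.* ν)) (λ q → asMatrix 𝒫 i q * X q l)) is is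
        ≈⟨ cauchyBinet (asMatrix 𝒫) X (List.allFin (n ℕ.* ν)) is is ⟩
      ∑sublists (List.allFin (n ℕ.* ν)) (λ qs → detᴸ (asMatrix 𝒫) is qs * detᴸ X qs is)
        ≈⟨ ∑sublists-tabulate id (λ qs → detᴸ (asMatrix 𝒫) is qs * detᴸ X qs is) ⟩
      ∑⊆ (λ 𝔷 → detᴸ (asMatrix 𝒫) is (map id (elementList 𝔷)) * detᴸ X (map id (elementList 𝔷)) is)
        ≈⟨ ∑⊆-cong (λ 𝔷 → trans (reflexive (≡.cong
             (λ qs → detᴸ (asMatrix 𝒫) is qs * detᴸ X qs is)
             (List.map-id (elementList 𝔷)))) (summand 𝔷)) ⟩
      ∑⊆ (λ 𝔷 → neg^ k (V * term 𝔷))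
        ≈⟨ neg^-∑⊆ k (λ 𝔷 → V * term 𝔷) ⟨
      neg^ k (∑⊆ (λ 𝔷 → V * term 𝔷))
        ≈⟨ neg^-cong k (*-distribˡ-∑⊆ V term) ⟨
      neg^ k (V * ∑⊆ term) ∎
      where
      term : Subset (n ℕ.* ν) → Carrier
      term 𝔷 = restrict (𝔷 ∈ℨ?) λ 𝔷∈ℨ →
        det (columns (asMatrix 𝒫) 𝔷 (∣𝔷∣≡N 𝔷 𝔷∈ℨ)) * ⟦ partialSchur (positions v) (Λ 𝔷 𝔷∈ℨ) ⟧

    -- Each factor involves the positions of a single letter, listed in increasing order, so the
    -- hypothesis orders all of its points.
    vandermondes-positive : (∀ i j → i Fin.< j → lookup v i ≡ lookup v j → x i < x j) → 0# < V
    vandermondes-positive x-mono = ∏-positive _ λ s → Δ-positive (points v ν x s) λ {i} {j} i<j →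
      x-mono _ _ (elements-mono (positions v s) i<j)
        (≡.trans (lookup-positions v s i) (≡.sym (lookup-positions v s j)))

    -- In `det-modelMatrix` the positive factor `V` leaves the sign unchanged, and the k = inv(v)
    -- negations amount to `σ v`.
    sign-det-modelMatrix : (∀ i j → i Fin.< j → lookup v i ≡ lookup v j → x i < x j) →
      sign (det (modelMatrix v 𝒫 x)) ≡ σ v ℤ.* sign (minorSchurSum v 𝒫 x)
    sign-det-modelMatrix x-mono = ≡.trans (sign-cong det-modelMatrix)
      (≡.trans (sign-neg^ k (V * minorSchurSum v 𝒫 x))
        (≡.cong₂ (λ j s → -1ℤ ℤ.^ j ℤ.* s) (≡.sym (inversions≡inv v))
          (sign-*-positive (minorSchurSum v 𝒫 x) (vandermondes-positive x-mono))))

corollary2 : ∀ {a ℓ c ℓ₁ ℓ₂}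
    (𝒲 : CoxeterSystem a ℓ) (ℝ : RealNumbers c ℓ₁ ℓ₂) →
    let open CoxeterSystem 𝒲
        open RealNumbers ℝ
        open Model ℝ in
    Finite → Irreducible →
    (w∘ : Group.Carrier W) (N : ℕ) → IsLongest w∘ N →
    (ν : ℕ) → IsMaxOccurrences w∘ N ν →
    (𝒫 : ParameterTensor N rank ν) →
    (v : Vec (Fin rank) N) → IsReducedWord w∘ v →
    (x : Fin N → Carrier) →
    (∀ i → 0# < x i) →
    (∀ i j → i Fin.< j → lookup v i ≡ lookup v j → x i < x j) →
    sign (det (modelMatrix v 𝒫 x)) ≡ σ v ℤ.* sign (minorSchurSum v 𝒫 x)
corollary2 𝒲 ℝ _ _ _ _ _ _ _ 𝒫 v _ x _ x-mono = SignFormula.sign-det-modelMatrix ℝ v 𝒫 x x-mono
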